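{- Let $A\subseteq 2^\omega$ be $\mu$-measurable. If $\Phi(A)\neq\emptyset$ and $\Phi(A)$ has empty interior, then $\Phi(A)$ is a complete $\boldsymbol{\Pi}^0_3$ set.
   Context: $2^\omega$ is the Cantor space with the product topology; $N_s=\{x\in 2^\omega: s\subset x\}$ for finite binary $s$. $\mu$ is the coin-tossing measure on $2^\omega$ with $\mu(N_s)=2^{ -\mathrm{lh}(s)}$. For measurable $A$, $\Phi(A)=\{x: \lim_{n}\mu(A\cap N_{x\restriction n})/\mu(N_{x\restriction n})=1\}$. $\boldsymbol{\Pi}^0_3$ is the class of $F_{\sigma\delta}$ sets; $X\subseteq 2^\omega$ is complete $\boldsymbol{\Pi}^0_3$ if $X\in\boldsymbol{\Pi}^0_3$ and every $\boldsymbol{\Pi}^0_3$ subset of $2^\omega$ is a continuous preimage $f^{ -1}(X)$ with $f:2^\omega\to 2^\omega$ continuous (equivalently $X$ is $F_{\sigma\delta}$ but not $G_{\delta\sigma}$). -}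

module Defs where

open import Data.Bool.Base using (Bool; true; false)
open import Data.List.Base using (List; []; _∷_; length; applyUpTo; replicate)
open import Data.Nat.Base as ℕ using (ℕ; zero; suc)
open import Data.Product.Base using (Σ; Σ-syntax; ∃; ∃-syntax; _×_; _,_; proj₁; proj₂)
open import Data.Rational
open import Data.Rational.Properties
open import Function.Base using (_∘_)
open import Function.Bundles using (Func; _⇔_)
open import Level using (0ℓ)
open import Relation.Binary.Bundles using (Setoid)
open import Relation.Binary.Definitions using (_Respects_)
open import Relation.Binary.PropositionalEquality hiding (resp)
open import Relation.Nullary.Negation.Core using (¬_)
open import Relation.Unary using (Pred)

------------------------------------------------------------------------
-- Real numbers

-- One-sided Dedekind cuts: a real α is given by the set of rationals q
-- with α < q.  Classically these are exactly the reals (the lower cut is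
-- the interior of the complement), and infima are computed by unions.
record ℝ : Set₁ where
  field
    upper     : ℚ → Set
    up-closed : ∀ {p q} → p < q → upper p → upper q
    rounded   : ∀ {q} → upper q → ∃[ p ] p < q × upper p
    inhabited : ∃[ q ] upper q
    bounded   : ∃[ q ] ¬ upper q

open ℝ public

infix 4 _≃ℝ_ _<ℝ_
infixl 6 _+ℝ_
infixl 7 _÷ℝ_

_≃ℝ_ : ℝ → ℝ → Set
α ≃ℝ β = ∀ q → upper α q ⇔ upper β q

_<ℝ_ : ℝ → ℝ → Set
α <ℝ β = ∃[ q ] upper α q × ¬ upper β q

fromℚ : ℚ → ℝ
fromℚ a = record
  { upper     = a <_
  ; up-closed = λ p<q a<p → <-trans a<p p<q
  ; rounded   = λ a<q → let (m , a<m , m<q) = <-dense a<q in m , m<q , a<m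
  ; inhabited = a + 1ℚ , subst (_< a + 1ℚ) (+-identityʳ a) (+-monoʳ-< a (positive⁻¹ 1ℚ))
  ; bounded   = a , <-irrefl refl
  }

private
  below : ∀ (α : ℝ) {a r} → ¬ upper α a → upper α r → a < r
  below α {a} {r} a∉ r∈ = ≰⇒> λ r≤a →
    let (p , p<r , p∈) = rounded α r∈ in a∉ (up-closed α (<-≤-trans p<r r≤a) p∈)

_+ℝ_ : ℝ → ℝ → ℝ
α +ℝ β = record
  { upper     = λ q → ∃[ r ] ∃[ s ] upper α r × upper β s × r + s ≤ q
  ; up-closed = λ { p<q (r , s , r∈ , s∈ , le) →
                    r , s , r∈ , s∈ , ≤-trans le (<⇒≤ p<q) }
  ; rounded   = λ { (r , s , r∈ , s∈ , le) →
                    let (r′ , r′<r , r′∈) = rounded α r∈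
                    in r′ + s , <-≤-trans (+-monoˡ-< s r′<r) le
                     , r′ , s , r′∈ , s∈ , ≤-refl }
  ; inhabited = let (r , r∈) = inhabited α ; (s , s∈) = inhabited β
                in r + s , r , s , r∈ , s∈ , ≤-refl
  ; bounded   = let (a , a∉) = bounded α ; (b , b∉) = bounded β
                in a + b , λ { (r , s , r∈ , s∈ , le) →
                     <-irrefl refl
                       (<-≤-trans (+-mono-< (below α a∉ r∈) (below β b∉ s∈)) le) }
  }

-- α ÷ c < q  iff  α < q · c,  for c > 0.
_÷ℝ_ : ℝ → (c : ℚ) → .{{Positive c}} → ℝ
_÷ℝ_ α c = record
  { upper     = λ q → upper α (q * c)
  ; up-closed = λ p<q → up-closed α (*-monoˡ-<-pos c p<q)
  ; rounded   = λ {q} q∈ →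
      let (r , r<qc , r∈) = rounded α q∈
      in r * c⁻¹
       , *-cancelʳ-<-nonNeg c {{pos⇒nonNeg c}} (subst (_< q * c) (sym (cancel r)) r<qc)
       , subst (upper α) (sym (cancel r)) r∈
  ; inhabited = let (r , r∈) = inhabited α in r * c⁻¹ , subst (upper α) (sym (cancel r)) r∈
  ; bounded   = let (r , r∉) = bounded α in r * c⁻¹ , λ h → r∉ (subst (upper α) (cancel r) h)
  }
  where
  c⁻¹ : ℚ
  c⁻¹ = (1/ c) {{pos⇒nonZero c}}

  cancel : ∀ r → r * c⁻¹ * c ≡ r
  cancel r = trans (*-assoc r c⁻¹ c)
    (trans (cong (r *_) (*-inverseˡ c {{pos⇒nonZero c}})) (*-identityʳ r))

-- |aₙ − L| < ε is spelled out as  aₙ < L + ε  and  L < aₙ + ε.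
Converges : (ℕ → ℝ) → ℝ → Set
Converges a L = ∀ ε → 0ℚ < ε → ∃[ N ] ∀ n → N ℕ.≤ n →
  (a n <ℝ L +ℝ fromℚ ε) × (L <ℝ a n +ℝ fromℚ ε)

------------------------------------------------------------------------
-- The Cantor space and its subsets

-- Points are identified when they agree pointwise; without function
-- extensionality this has to be imposed on subsets and on functions.
Cantor : Setoid 0ℓ 0ℓ
Cantor = ℕ →-setoid Bool

2^ω : Set
2^ω = ℕ → Bool

record Subset : Set₁ where
  field
    pred : Pred 2^ω 0ℓ
    resp : pred Respects _≗_

open Subset public

infix 4 _∈_ _∉_ _⊆_ _≐_
infixr 7 _∩_

_∈_ _∉_ : 2^ω → Subset → Set
x ∈ A = pred A x
x ∉ A = ¬ (x ∈ A)

_⊆_ _≐_ : Subset → Subset → Set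
A ⊆ B = ∀ {x} → x ∈ A → x ∈ B
A ≐ B = ∀ x → x ∈ A ⇔ x ∈ B

_∩_ : Subset → Subset → Subset
A ∩ B = record
  { pred = λ x → x ∈ A × x ∈ B
  ; resp = λ { x≗y (a , b) → resp A x≗y a , resp B x≗y b }
  }

∁ : Subset → Subset
∁ A = record
  { pred = _∉ A
  ; resp = λ x≗y x∉A y∈A → x∉A (resp A (sym ∘ x≗y) y∈A)
  }

preimage : Func Cantor Cantor → Subset → Subset
preimage f A = record
  { pred = λ x → Func.to f x ∈ A
  ; resp = λ {x} {y} x≗y → resp A (Func.cong f {x} {y} x≗y)
  }

infix 8 _↾_

_↾_ : 2^ω → ℕ → List Bool
x ↾ n = applyUpTo x n

↾-cong : ∀ {x y : 2^ω} → x ≗ y → ∀ n → x ↾ n ≡ y ↾ n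
↾-cong x≗y zero    = refl
↾-cong x≗y (suc n) = cong₂ _∷_ (x≗y 0) (↾-cong (x≗y ∘ suc) n)

N : List Bool → Subset
N s = record
  { pred = λ x → x ↾ length s ≡ s
  ; resp = λ x≗y x∈ → trans (sym (↾-cong x≗y (length s))) x∈
  }

------------------------------------------------------------------------
-- The product topology

interior : Subset → Subset
interior A = record
  { pred = λ x → ∃[ s ] x ∈ N s × N s ⊆ A
  ; resp = λ { x≗y (s , x∈ , sub) → s , resp (N s) x≗y x∈ , sub }
  }

Open Closed : Subset → Set
Open U = U ⊆ interior U
Closed F = Open (∁ F)

Continuous : Func Cantor Cantor → Set₁
Continuous f = ∀ U → Open U → Open (preimage f U)

Nonempty Empty : Subset → Set
Nonempty A = ∃[ x ] x ∈ A
Empty A = ∀ x → x ∉ A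

-- F_σδ: a countable intersection of countable unions of closed sets.
Π⁰₃ : Subset → Set₁
Π⁰₃ X = Σ[ F ∈ (ℕ → ℕ → Subset) ]
  (∀ m n → Closed (F m n)) × (∀ x → x ∈ X ⇔ (∀ m → ∃[ n ] x ∈ F m n))

CompleteΠ⁰₃ : Subset → Set₁
CompleteΠ⁰₃ X = Π⁰₃ X ×
  (∀ Y → Π⁰₃ Y → Σ[ f ∈ Func Cantor Cantor ] Continuous f × Y ≐ preimage f X)

------------------------------------------------------------------------
-- The coin-tossing measure

2^- : ℕ → ℚ
2^- zero    = 1ℚ
2^- (suc n) = ½ * 2^- n

2^-positive : ∀ n → Positive (2^- n)
2^-positive zero    = _
2^-positive (suc n) = pos*pos⇒pos ½ (2^- n) {{2^-positive n}}

partialSum : (ℕ → List Bool) → ℕ → ℚ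
partialSum c zero    = 0ℚ
partialSum c (suc n) = partialSum c n + 2^- (length (c n))

Covers : (ℕ → List Bool) → Subset → Set
Covers c A = ∀ x → x ∈ A → ∃[ i ] x ∈ N (c i)

private
  -- The whole space is covered by N [] together with ever smaller cylinders.
  trivialCover : ℕ → List Bool
  trivialCover n = replicate n true

  length-replicate′ : ∀ n → length (replicate n true) ≡ n
  length-replicate′ zero    = refl
  length-replicate′ (suc n) = cong suc (length-replicate′ n)

  half+half : ∀ q → ½ * q + ½ * q ≡ q
  half+half q = trans (sym (*-distribʳ-+ q ½ ½)) (*-identityˡ q)

  trivialSum : ∀ n → partialSum trivialCover n + (2^- n + 2^- n) ≡ 1ℚ + 1ℚ
  trivialSum zero    = refl
  trivialSum (suc n) rewrite length-replicate′ n =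
    trans (+-assoc (partialSum trivialCover n) (2^- n) _)
      (trans (cong (λ t → partialSum trivialCover n + (2^- n + t)) (half+half (2^- n)))
        (trivialSum n))

  trivialSum≤2 : ∀ n → partialSum trivialCover n ≤ 1ℚ + 1ℚ
  trivialSum≤2 n = subst (partialSum trivialCover n ≤_) (trivialSum n)
    (subst (_≤ partialSum trivialCover n + (2^- n + 2^- n))
      (+-identityʳ (partialSum trivialCover n))
      (+-monoʳ-≤ (partialSum trivialCover n)
        (+-mono-≤ {0ℚ} {_} {0ℚ} 0≤ 0≤)))
    where
    0≤ : 0ℚ ≤ 2^- n
    0≤ = <⇒≤ (positive⁻¹ (2^- n) {{2^-positive n}})

-- Outer measure: the infimum, over countable covers of A by cylinders
-- N (c i), of the sums Σᵢ 2^-lh(c i).  A sum of nonnegative terms is < q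
-- iff its partial sums are bounded by some r < q.
μ* : Subset → ℝ
μ* A = record
  { upper     = λ q → ∃[ c ] Covers c A × ∃[ r ] r < q × (∀ n → partialSum c n ≤ r)
  ; up-closed = λ { p<q (c , cov , r , r<p , le) → c , cov , r , <-trans r<p p<q , le }
  ; rounded   = λ { (c , cov , r , r<q , le) →
                    let (m , r<m , m<q) = <-dense r<q in m , m<q , c , cov , r , r<m , le }
  ; inhabited = 1ℚ + 1ℚ + 1ℚ , trivialCover , (λ _ _ → 0 , refl)
              , 1ℚ + 1ℚ , +-monoʳ-< (1ℚ + 1ℚ) (positive⁻¹ 1ℚ) , trivialSum≤2
  ; bounded   = 0ℚ , λ { (_ , _ , _ , r<0 , le) → <-irrefl refl (≤-<-trans (le 0) r<0) }
  }

-- Carathéodory's condition.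
Measurable : Subset → Set₁
Measurable A = ∀ E → μ* E ≃ℝ μ* (E ∩ A) +ℝ μ* (E ∩ ∁ A)

-- μ(A ∩ N s) / μ(N s), where μ(N s) = 2^-lh(s); on measurable sets μ is
-- the restriction of μ*.
density : Subset → List Bool → ℝ
density A s = (μ* (A ∩ N s) ÷ℝ 2^- (length s)) {{2^-positive (length s)}}

Φ : Subset → Subset
Φ A = record
  { pred = λ x → Converges (λ n → density A (x ↾ n)) (fromℚ 1ℚ)
  ; resp = λ x≗y lim ε 0<ε → let (M , h) = lim ε 0<ε in M , λ n M≤n →
      subst (λ s → (density A s <ℝ fromℚ 1ℚ +ℝ fromℚ ε) × (fromℚ 1ℚ <ℝ density A s +ℝ fromℚ ε))
        (↾-cong x≗y n) (h n M≤n)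
  }

{-# OPTIONS --safe #-}

-- Membership in Φ A says that the outer density of A on the cylinders around x is at least
-- 1 - 2^-l from some point on, for every l; this is Π⁰₃ on the face of it.
--
-- Hardness: Y ∈ Π⁰₃ is first encoded by a sequence a of naturals depending continuously on x,
-- with x ∈ Y iff a tends to infinity.  Such a sequence is then played out along a branch.  From
-- a cylinder with density at least 1 - 2^-(i+1) one can climb to density arbitrarily close to 1
-- without passing below 1 - 2^-i: otherwise, iterating covers that lose a fixed proportion
-- while discarding the low cylinders at relative cost 1 - 2^-i would make the density too
-- small.  Since Φ A has empty interior, below every cylinder there is one of small density, and
-- as 1 - density at most doubles in one step, one can descend to a density that is just
-- below 1 - 2^-(a+2) and still at least 1 - 2^-(a+1).  Doing this for a = a 0, a 1, … makes the
-- density converge to 1 exactly if a tends to infinity.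

module Submission where

open import Defs
open import Axiom.ExcludedMiddle using (ExcludedMiddle)
open import Data.Bool.Base using (Bool; true; false; not; if_then_else_)
open import Data.Bool.Properties using (_≟_)
open import Data.Empty using (⊥-elim)
import Data.Integer.Base as ℤ
import Data.Integer.Solver as ℤ
open import Data.List.Base using (List; []; _∷_; _++_; length; map; replicate; take)
open import Data.List.Properties
  using (length-replicate; length-applyUpTo; length-++; ++-identityʳ; take-all; take-[]; ∷-injectiveˡ; ∷-injectiveʳ)
open import Data.List.Relation.Unary.Any as Any using (Any; here; there)
import Data.List.Relation.Unary.Any.Properties as Any
open import Data.Maybe.Base using (Maybe; just; nothing)
open import Data.Nat.Base as ℕ using (ℕ; zero; suc)
import Data.Nat.Properties as ℕ
open import Data.Product.Base using (Σ-syntax; ∃-syntax; _×_; _,_; proj₁; proj₂)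
open import Data.Rational hiding (_≟_)
open import Data.Rational.Properties hiding (_≟_)
open import Data.Rational.Solver using (module +-*-Solver)
import Data.Rational.Unnormalised.Base as ℚᵘ
import Data.Rational.Unnormalised.Properties as ℚᵘ
open import Data.Sum.Base using (_⊎_; inj₁; inj₂)
open import Function.Base using (_∘_; case_of_)
open import Function.Bundles using (Func; _⇔_; mk⇔; Equivalence)
open import Level using (0ℓ)
open import Relation.Binary.PropositionalEquality hiding (resp)
open import Relation.Nullary using (¬_; yes; no; does)
open import Relation.Nullary.Decidable using (dec-true)
open Equivalence using (to; from)
open +-*-Solver

-- Rational arithmetic

≤-by : ∀ {a b} c → a + c ≡ b → 0ℚ ≤ c → a ≤ b
≤-by {a} c eq 0≤c = subst₂ _≤_ (+-identityʳ a) eq (+-monoʳ-≤ a 0≤c)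

+-nonNeg : ∀ {x y} → 0ℚ ≤ x → 0ℚ ≤ y → 0ℚ ≤ x + y
+-nonNeg = +-mono-≤ {0ℚ} {_} {0ℚ}

*-nonNeg : ∀ {x y} → 0ℚ ≤ x → 0ℚ ≤ y → 0ℚ ≤ x * y
*-nonNeg {x} {y} 0≤x 0≤y =
  subst (_≤ x * y) (*-zeroʳ x) (*-monoˡ-≤-nonNeg x {{nonNegative 0≤x}} 0≤y)

0≤1 : 0ℚ ≤ 1ℚ
0≤1 = nonNegative⁻¹ 1ℚ

opaque
  avg : ℚ → ℚ → ℚ
  avg x y = ½ * (x + y)

  avg-mono : ∀ {x x′ y y′} → x ≤ x′ → y ≤ y′ → avg x y ≤ avg x′ y′
  avg-mono x≤x′ y≤y′ = *-monoˡ-≤-nonNeg ½ (+-mono-≤ x≤x′ y≤y′)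

  avg-idem : ∀ x → avg x x ≡ x
  avg-idem = solve 1 (λ x → con ½ :* (x :+ x) := x) refl

  avg-0 : ∀ x → avg x 0ℚ ≡ ½ * x
  avg-0 x = cong (½ *_) (+-identityʳ x)

  ½-+-½ : ∀ x y → ½ * x + ½ * y ≡ avg x y
  ½-+-½ x y = sym (*-distribˡ-+ ½ x y)

  avg-comm : ∀ x y → avg x y ≡ avg y x
  avg-comm x y = cong (½ *_) (+-comm x y)

  avg-distrib-+ : ∀ x y x′ y′ → avg x y + avg x′ y′ ≡ avg (x + x′) (y + y′)
  avg-distrib-+ = solve 4 (λ x y x′ y′ →
    con ½ :* (x :+ y) :+ con ½ :* (x′ :+ y′) := con ½ :* ((x :+ x′) :+ (y :+ y′))) refl

  avg-translate : ∀ a x y → avg (a + x) (a + y) ≡ a + avg x y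
  avg-translate = solve 3 (λ a x y →
    con ½ :* ((a :+ x) :+ (a :+ y)) := a :+ con ½ :* (x :+ y)) refl

  avg-affine : ∀ a c x y → avg (a + c * x) (a + c * y) ≡ a + c * avg x y
  avg-affine = solve 4 (λ a c x y →
    con ½ :* ((a :+ c :* x) :+ (a :+ c :* y)) := a :+ c :* (con ½ :* (x :+ y))) refl

  avg-doubled : ∀ x y → x + y ≡ avg x y + avg x y
  avg-doubled = solve 2 (λ x y →
    x :+ y := con ½ :* (x :+ y) :+ con ½ :* (x :+ y)) refl

  avg-nonNeg : ∀ {x y} → 0ℚ ≤ x → 0ℚ ≤ y → 0ℚ ≤ avg x y
  avg-nonNeg = avg-mono {0ℚ} {_} {0ℚ}

  avg≤ : ∀ {x y z} → x ≤ z → y ≤ z → avg x y ≤ z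
  avg≤ x≤z y≤z = ≤-trans (avg-mono x≤z y≤z) (≤-reflexive (avg-idem _))

  avg-1<1- : ∀ {r} w → r < 1ℚ - w → avg r 1ℚ < 1ℚ - ½ * w
  avg-1<1- w r<1-w = <-respʳ-≡
    (solve 1 (λ w → con ½ :* ((con 1ℚ :- w) :+ con 1ℚ) := con 1ℚ :- con ½ :* w) refl w)
    (*-monoʳ-<-pos ½ (+-monoˡ-< 1ℚ r<1-w))

0<2^- : ∀ n → 0ℚ < 2^- n
0<2^- n = positive⁻¹ (2^- n) {{2^-positive n}}

0≤2^- : ∀ n → 0ℚ ≤ 2^- n
0≤2^- n = <⇒≤ (0<2^- n)

2^-halves : ∀ n → 2^- (suc n) + 2^- (suc n) ≡ 2^- n
2^-halves n = solve 1 (λ x → con ½ :* x :+ con ½ :* x := x) refl (2^- n)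

2^-suc≤ : ∀ n → 2^- (suc n) ≤ 2^- n
2^-suc≤ n = ≤-by (2^- (suc n)) (2^-halves n) (0≤2^- (suc n))

2^-antitone′ : ∀ {m n} → m ℕ.≤′ n → 2^- n ≤ 2^- m
2^-antitone′ (ℕ.≤′-reflexive refl) = ≤-refl
2^-antitone′ (ℕ.≤′-step {n} m≤n) = ≤-trans (2^-suc≤ n) (2^-antitone′ m≤n)

2^-antitone : ∀ {m n} → m ℕ.≤ n → 2^- n ≤ 2^- m
2^-antitone m≤n = 2^-antitone′ (ℕ.≤⇒≤′ m≤n)

1-2^-mono : ∀ {m n} → m ℕ.≤ n → 1ℚ - 2^- m ≤ 1ℚ - 2^- n
1-2^-mono m≤n = +-monoʳ-≤ 1ℚ (neg-antimono-≤ (2^-antitone m≤n))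

1-2^-nonNeg : ∀ n → 0ℚ ≤ 1ℚ - 2^- n
1-2^-nonNeg n = 1-2^-mono {0} {n} ℕ.z≤n

times : ℕ → ℚ → ℚ
times zero    q = 0ℚ
times (suc k) q = q + times k q

times-nonNeg : ∀ k {q} → 0ℚ ≤ q → 0ℚ ≤ times k q
times-nonNeg zero    0≤q = ≤-refl
times-nonNeg (suc k) 0≤q = +-nonNeg 0≤q (times-nonNeg k 0≤q)

times-mono : ∀ k {p q} → p ≤ q → times k p ≤ times k q
times-mono zero    p≤q = ≤-refl
times-mono (suc k) p≤q = +-mono-≤ p≤q (times-mono k p≤q)

times-*ˡ : ∀ k c q → times k (c * q) ≡ c * times k q
times-*ˡ zero    c q = sym (*-zeroʳ c)
times-*ˡ (suc k) c q = trans (cong ((c * q) +_) (times-*ˡ k c q)) (sym (*-distribˡ-+ c q _))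

times-2^- : ∀ k → times k (2^- k) < 1ℚ
times-2^- zero    = positive⁻¹ 1ℚ
times-2^- (suc k) = ≤-<-trans
  (≤-reflexive (trans (cong ((½ * 2^- k) +_) (times-*ˡ k ½ (2^- k))) (sym (*-distribˡ-+ ½ (2^- k) (times k (2^- k))))))
  (*-monoʳ-<-pos ½ {2^- k + times k (2^- k)} {1ℚ + 1ℚ}
    (+-mono-≤-< (2^-antitone {0} {k} ℕ.z≤n) (times-2^- k)))

toℚᵘ-times : ∀ k q → toℚᵘ (times k q) ℚᵘ.≃ ℚᵘ.mkℚᵘ (ℤ.+ k ℤ.* ↥ q) (ℚ.denominator-1 q)
toℚᵘ-times zero    q = ℚᵘ.*≡* refl
toℚᵘ-times (suc k) q@record{} = ℚᵘ.≃-trans (toℚᵘ-homo-+ q (times k q))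
  (ℚᵘ.≃-trans (ℚᵘ.+-congʳ (toℚᵘ q) (toℚᵘ-times k q))
    (ℚᵘ.*≡* (ring (↥ q) (↧ q) (ℤ.+ k))))
  where
  open ℤ.+-*-Solver renaming (solve to ℤsolve; _:+_ to _⊕_; _:*_ to _⊗_; _:=_ to _≜_; con to c′)
  ring : ∀ n d k → (n ℤ.* d ℤ.+ k ℤ.* n ℤ.* d) ℤ.* d ≡ (ℤ.+ 1 ℤ.+ k) ℤ.* n ℤ.* (d ℤ.* d)
  ring = ℤsolve 3 (λ n d k →
    ((n ⊗ d ⊕ k ⊗ n ⊗ d) ⊗ d) ≜ ((c′ (ℤ.+ 1) ⊕ k) ⊗ n ⊗ (d ⊗ d))) refl

-- The denominator of `q` serves as `k`: that many copies of `q` add up to its numerator, a positive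
-- integer.
archimedean : ∀ {q} → 0ℚ < q → ∃[ k ] 1ℚ ≤ times k q
archimedean {q@(mkℚ (ℤ.+ 0) d c)} 0<q with () ← positive 0<q
archimedean {q@(mkℚ (ℤ.-[1+ n ]) d c)} 0<q with () ← positive 0<q
archimedean {q@(mkℚ (ℤ.+ suc n) d c)} 0<q = suc d , toℚᵘ-cancel-≤
  (ℚᵘ.≤-trans (ℚᵘ.*≤* (ℤ.+≤+ (ℕ.≤-trans (ℕ.≤-reflexive (ℕ.*-identityˡ (suc d)))
    (ℕ.≤-trans (ℕ.m≤m*n (suc d) (suc n)) (ℕ.≤-reflexive (sym (ℕ.*-identityʳ _)))))))
    (ℚᵘ.≤-reflexive (ℚᵘ.≃-sym (toℚᵘ-times (suc d) q))))

2^-small : ∀ {q} → 0ℚ < q → ∃[ k ] 2^- k < q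
2^-small 0<q with k , 1≤kq ← archimedean 0<q =
  k , ≰⇒> λ q≤2^- → <-irrefl refl
    (≤-<-trans (≤-trans 1≤kq (times-mono k q≤2^-)) (times-2^- k))

pow : ℚ → ℕ → ℚ
pow θ zero    = 1ℚ
pow θ (suc k) = θ * pow θ k

pow-nonNeg : ∀ {θ} k → 0ℚ ≤ θ → 0ℚ ≤ pow θ k
pow-nonNeg zero    0≤θ = 0≤1
pow-nonNeg (suc k) 0≤θ = *-nonNeg 0≤θ (pow-nonNeg k 0≤θ)

-- Bernoulli's inequality in product form, free of division. The induction uses that (1 - η)(1 + η +
-- t) falls short of 1 + t by η(η + t).
bernoulli : ∀ k {η} → 0ℚ ≤ η → 0ℚ ≤ 1ℚ - η → pow (1ℚ - η) k * (1ℚ + times k η) ≤ 1ℚ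
bernoulli zero    0≤η 0≤θ = ≤-refl
bernoulli (suc k) {η} 0≤η 0≤θ = ≤-trans
  (≤-by (p * (η * (η + t))) (ring p η t)
    (*-nonNeg (pow-nonNeg k 0≤θ) (*-nonNeg 0≤η (+-nonNeg 0≤η (times-nonNeg k 0≤η)))))
  (bernoulli k 0≤η 0≤θ)
  where
  p t : ℚ
  p = pow (1ℚ - η) k
  t = times k η
  ring : ∀ p η t → (1ℚ - η) * p * (1ℚ + (η + t)) + p * (η * (η + t)) ≡ p * (1ℚ + t)
  ring = solve 3 (λ p η t → (con 1ℚ :- η) :* p :* (con 1ℚ :+ (η :+ t)) :+ p :* (η :* (η :+ t))
    := p :* (con 1ℚ :+ t)) refl

pow<½ : ∀ {η} → 0ℚ < η → 0ℚ ≤ 1ℚ - η → ∃[ k ] pow (1ℚ - η) k < ½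
pow<½ {η} 0<η 0≤θ with k , 1≤kη ← archimedean 0<η = suc k , ≰⇒> λ ½≤p →
  let t = η + times k η
      1<t : 1ℚ < t
      1<t = ≤-<-trans 1≤kη (<-respˡ-≡ (+-identityˡ _) (+-monoˡ-< (times k η) 0<η))
      0≤1+t = +-nonNeg 0≤1 (<⇒≤ (<-trans (positive⁻¹ 1ℚ) 1<t))
  in <-irrefl refl (<-≤-trans (*-monoʳ-<-pos ½ (+-monoʳ-< 1ℚ 1<t))
      (≤-trans (*-monoʳ-≤-nonNeg (1ℚ + t) {{nonNegative 0≤1+t}} ½≤p)
        (bernoulli (suc k) (<⇒≤ 0<η) 0≤θ)))

1-2^-≤1 : ∀ n → 1ℚ - 2^- n ≤ 1ℚ
1-2^-≤1 n = ≤-by (2^- n) (solve 1 (λ w → con 1ℚ :- w :+ w := con 1ℚ) refl (2^- n)) (0≤2^- n)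

-- Covers and outer density

infixr 5 _◂_
infixl 6 _↓_

_◂_ : Bool → 2^ω → 2^ω
(b ◂ x) zero    = b
(b ◂ x) (suc n) = x n

◂-cong : ∀ b {x y} → x ≗ y → b ◂ x ≗ b ◂ y
◂-cong b x≗y zero    = refl
◂-cong b x≗y (suc n) = x≗y n

◂-η : ∀ x → x ≗ x 0 ◂ (x ∘ suc)
◂-η x zero    = refl
◂-η x (suc n) = refl

child : Subset → Bool → Subset
child B b = record { pred = λ x → b ◂ x ∈ B ; resp = λ x≗y → resp B (◂-cong b x≗y) }

-- Magnifies the part of `B` inside `N s` to the whole space, so that the relative outer measure of
-- `B` in `N s` becomes the plain outer measure of `B ↓ s`.
_↓_ : Subset → List Bool → Subset
B ↓ []      = B
B ↓ (b ∷ s) = child B b ↓ s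

↓-++ : ∀ B s u → B ↓ (s ++ u) ≡ B ↓ s ↓ u
↓-++ B []      u = refl
↓-++ B (b ∷ s) u = ↓-++ (child B b) s u

tail-∈ : ∀ B {x} → x ∈ B → x ∘ suc ∈ child B (x 0)
tail-∈ B {x} = resp B (◂-η x)

-- Covers are coded as sets of strings, not as sequences: the measure of the union of the cylinders
-- is then computed by recursion on the bits, with no double counting.
StringSet : Set
StringSet = List Bool → Bool

branch : Bool → StringSet → StringSet
branch b P u = P (b ∷ u)

-- The measure of the set of points meeting P within their first n bits.
V : ℕ → StringSet → ℚ
V zero    P = if P [] then 1ℚ else 0ℚ
V (suc n) P = if P [] then 1ℚ else avg (V n (branch true P)) (V n (branch false P))

V-hit : ∀ n P → P [] ≡ true → V n P ≡ 1ℚ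
V-hit zero    P hit rewrite hit = refl
V-hit (suc n) P hit rewrite hit = refl

V-miss : ∀ n P → P [] ≡ false → V (suc n) P ≡ avg (V n (branch true P)) (V n (branch false P))
V-miss n P miss rewrite miss = refl

V-nonNeg : ∀ n P → 0ℚ ≤ V n P
V-nonNeg zero P with P []
... | true  = 0≤1
... | false = ≤-refl
V-nonNeg (suc n) P with P []
... | true  = 0≤1
... | false = avg-nonNeg (V-nonNeg n (branch true P)) (V-nonNeg n (branch false P))

V≤1 : ∀ n P → V n P ≤ 1ℚ
V≤1 zero P with P []
... | true  = ≤-refl
... | false = 0≤1
V≤1 (suc n) P with P []
... | true  = ≤-refl
... | false = avg≤ (V≤1 n (branch true P)) (V≤1 n (branch false P))

V-suc : ∀ n P → V n P ≤ V (suc n) P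
V-suc zero P with P []
... | true  = ≤-refl
... | false = avg-nonNeg (V-nonNeg 0 (branch true P)) (V-nonNeg 0 (branch false P))
V-suc (suc n) P with P []
... | true  = ≤-refl
... | false = avg-mono (V-suc n (branch true P)) (V-suc n (branch false P))

V-mono′ : ∀ {m n} P → m ℕ.≤′ n → V m P ≤ V n P
V-mono′ P (ℕ.≤′-reflexive refl)  = ≤-refl
V-mono′ P (ℕ.≤′-step {n} m≤n) = ≤-trans (V-mono′ P m≤n) (V-suc n P)

V-mono : ∀ {m n} P → m ℕ.≤ n → V m P ≤ V n P
V-mono P m≤n = V-mono′ P (ℕ.≤⇒≤′ m≤n)

V-cong : ∀ n {P Q : StringSet} → P ≗ Q → V n P ≡ V n Q
V-cong zero    P≗Q rewrite P≗Q [] = refl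
V-cong (suc n) {P} {Q} P≗Q rewrite P≗Q []
  | V-cong n {branch true P} {branch true Q} (P≗Q ∘ (true ∷_))
  | V-cong n {branch false P} {branch false Q} (P≗Q ∘ (false ∷_)) = refl

V-branch : ∀ n P b → V n (branch b P) ≤ V (suc n) P + V (suc n) P
V-branch n P b with P []
... | true = ≤-trans (V≤1 n (branch b P)) (≤-by {1ℚ} 1ℚ refl 0≤1)
V-branch n P true  | false = ≤-by q (avg-doubled p q) (V-nonNeg n (branch false P))
  where p = V n (branch true P) ; q = V n (branch false P)
V-branch n P false | false = ≤-by p (trans (+-comm q p) (avg-doubled p q)) (V-nonNeg n (branch true P))
  where p = V n (branch true P) ; q = V n (branch false P)

Covers′ : StringSet → Subset → Set
Covers′ P B = ∀ x → x ∈ B → ∃[ n ] P (x ↾ n) ≡ true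

infix 4 _CoveredWithin_

-- Some open set containing `B` has measure at most `r`. That measure is the supremum of the
-- increasing values `V n P`, so bounding all of them replaces a limit.
_CoveredWithin_ : Subset → ℚ → Set
B CoveredWithin r = ∃[ P ] Covers′ P B × (∀ n → V n P ≤ r)

CoveredWithin-weaken : ∀ B {r r′} → r ≤ r′ → B CoveredWithin r → B CoveredWithin r′
CoveredWithin-weaken B r≤r′ (P , cov , bd) = P , cov , λ n → ≤-trans (bd n) r≤r′

CoveredWithin-antitone : ∀ {B C r} → B ⊆ C → C CoveredWithin r → B CoveredWithin r
CoveredWithin-antitone B⊆C (P , cov , bd) = P , (λ x x∈ → cov x (B⊆C x∈)) , bd

CoveredWithin-1 : ∀ B → B CoveredWithin 1ℚ
CoveredWithin-1 B = (λ _ → true) , (λ _ _ → 0 , refl) , λ n → V≤1 n _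

branch-Covers′ : ∀ P B b → P [] ≡ false → Covers′ P B → Covers′ (branch b P) (child B b)
branch-Covers′ P B b miss cov x x∈ with cov (b ◂ x) x∈
... | zero  , hit with () ← trans (sym miss) hit
... | suc n , hit = n , hit

splice : Bool → StringSet → StringSet → StringSet
splice b P Q []      = false
splice b P Q (c ∷ u) = if does (c ≟ b) then P u else Q u

splice-same : ∀ b P Q c u → c ≡ b → splice b P Q (c ∷ u) ≡ P u
splice-same b P Q c u c≡b with c ≟ b
... | yes _  = refl
... | no c≢b = ⊥-elim (c≢b c≡b)

splice-other : ∀ b P Q c u → c ≢ b → splice b P Q (c ∷ u) ≡ Q u
splice-other b P Q c u c≢b with c ≟ b
... | yes c≡b = ⊥-elim (c≢b c≡b)
... | no _    = refl

V-splice : ∀ n b P Q → V (suc n) (splice b P Q) ≡ avg (V n P) (V n Q)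
V-splice n true  P Q = refl
V-splice n false P Q = avg-comm (V n Q) (V n P)

splice-hit : ∀ b P Q B → Covers′ P (child B b) → ∀ x → x ∈ B → x 0 ≡ b →
  ∃[ n ] splice b P Q (x ↾ n) ≡ true
splice-hit b P Q B cov x x∈ x0≡b
  with n , hit ← cov (x ∘ suc) (subst (λ c → x ∘ suc ∈ child B c) x0≡b (tail-∈ B x∈)) =
  suc n , trans (splice-same b P Q (x 0) _ x0≡b) hit

V-splice≤ : ∀ b P Q {p q} → (∀ n → V n P ≤ p) → (∀ n → V n Q ≤ q) →
  ∀ n → V n (splice b P Q) ≤ avg p q
V-splice≤ b P Q P≤ Q≤ zero    = avg-nonNeg (≤-trans (V-nonNeg 0 P) (P≤ 0)) (≤-trans (V-nonNeg 0 Q) (Q≤ 0))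
V-splice≤ b P Q P≤ Q≤ (suc n) = ≤-trans (≤-reflexive (V-splice n b P Q)) (avg-mono (P≤ n) (Q≤ n))

V-∅ : ∀ n → V n (λ _ → false) ≤ 0ℚ
V-∅ zero    = ≤-refl
V-∅ (suc n) = avg≤ (V-∅ n) (V-∅ n)

-- Outer density of B at least 1 - 2^-j.
Dense : ℕ → Subset → Set
Dense j B = ¬ (∃[ r ] r < 1ℚ - 2^- j × B CoveredWithin r)

Dense-mono : ∀ i j B → i ℕ.≤ j → Dense j B → Dense i B
Dense-mono i j B i≤j dense (r , r< , cov) = dense (r , <-≤-trans r< (1-2^-mono {i} {j} i≤j) , cov)

Dense-++⁻ : ∀ j B s u → Dense j (B ↓ (s ++ u)) → Dense j (B ↓ s ↓ u)
Dense-++⁻ j B s u = subst (Dense j) (↓-++ B s u)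

Dense-++⁺ : ∀ j B s u → Dense j (B ↓ s ↓ u) → Dense j (B ↓ (s ++ u))
Dense-++⁺ j B s u = subst (Dense j) (sym (↓-++ B s u))

-- A cheap cover of one half together with the whole other half costs the average of `r` and 1, and
-- averaging 1 - 2^-j with 1 gives 1 - 2^-(j+1).
Dense-child : ∀ j B b → Dense (suc j) B → Dense j (child B b)
Dense-child j B b dense (r , r< , P , cov , bd) =
  dense (avg r 1ℚ , avg-1<1- (2^- j) r< , splice b P (λ _ → true) , covers
        , V-splice≤ b P (λ _ → true) bd (λ n → V≤1 n _))
  where
  covers : Covers′ (splice b P (λ _ → true)) B
  covers x x∈ with x 0 ≟ b
  ... | yes x0≡b = splice-hit b P (λ _ → true) B cov x x∈ x0≡b
  ... | no x0≢b  = 1 , splice-other b P (λ _ → true) (x 0) [] x0≢b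

Along : (Subset → Set) → Subset → List Bool → Set
Along Q B []      = Q B
Along Q B (b ∷ u) = Q B × Along Q (child B b) u

Along-head : ∀ {Q B} u → Along Q B u → Q B
Along-head []      q       = q
Along-head (b ∷ u) (q , _) = q

Along-map : ∀ {Q R : Subset → Set} {B} u → (∀ {C} → Q C → R C) → Along Q B u → Along R B u
Along-map []      f q        = f q
Along-map (b ∷ u) f (q , qs) = f q , Along-map u f qs

Along-++ : ∀ {Q B} u v → Along Q B u → Along Q (B ↓ u) v → Along Q B (u ++ v)
Along-++ []      v _        qv = qv
Along-++ (b ∷ u) v (q , qs) qv = q , Along-++ u v qs qv

Along-take : ∀ {Q B} u m → Along Q B u → Q (B ↓ take m u)
Along-take u       zero    qs       = Along-head u qs
Along-take []      (suc m) q        = q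
Along-take (b ∷ u) (suc m) (q , qs) = Along-take u m qs


-- `W` proposes covers to be planted at certain strings. Only the shortest proposed prefix on each
-- branch is used, so the planted covers sit in disjoint cylinders.
graft : (List Bool → Maybe StringSet) → StringSet
graft W [] with W []
... | just Q  = Q []
... | nothing = false
graft W (b ∷ u) with W []
... | just Q  = Q (b ∷ u)
... | nothing = graft (W ∘ (b ∷_)) u

graft-just : ∀ W {Q} → W [] ≡ just Q → graft W ≗ Q
graft-just W eq []      rewrite eq = refl
graft-just W eq (b ∷ u) rewrite eq = refl

graft-nothing-[] : ∀ W → W [] ≡ nothing → graft W [] ≡ false
graft-nothing-[] W eq rewrite eq = refl

graft-nothing-∷ : ∀ W → W [] ≡ nothing → ∀ b → branch b (graft W) ≗ graft (W ∘ (b ∷_))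
graft-nothing-∷ W eq b u rewrite eq = refl

avg-V≤V : ∀ n P → avg (V n (branch true P)) (V n (branch false P)) ≤ V (suc n) P
avg-V≤V n P with P []
... | true  = avg≤ (V≤1 n _) (V≤1 n _)
... | false = ≤-refl

module _ {β c : ℚ} (0≤β : 0ℚ ≤ β) (0≤c : 0ℚ ≤ c) where

  affine-mono : ∀ {x y} → x ≤ y → β + c * x ≤ β + c * y
  affine-mono x≤y = +-monoʳ-≤ β (*-monoˡ-≤-nonNeg c {{nonNegative 0≤c}} x≤y)

  -- `V 0 (λ v → P (u ++ v))` is the indicator of `u` in `P`: planting may cost β + c at strings of
  -- `P` and β elsewhere. Averaging commutes with affine maps, so the bound integrates to β + c
  -- times the measure of `P`.
  V-graft : ∀ n W P → (∀ u Q → W u ≡ just Q → ∀ m → V m Q ≤ β + c * V 0 (λ v → P (u ++ v))) →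
    V n (graft W) ≤ β + c * V n P
  V-graft n W P bd with W [] in eq
  V-graft n W P bd | just Q =
    ≤-trans (≤-reflexive (V-cong n (graft-just W eq)))
      (≤-trans (bd [] Q eq n) (affine-mono (V-mono {0} {n} P ℕ.z≤n)))
  V-graft zero W P bd | nothing rewrite graft-nothing-[] W eq =
    +-nonNeg 0≤β (*-nonNeg 0≤c (V-nonNeg 0 P))
  V-graft (suc n) W P bd | nothing =
    ≤-trans (≤-reflexive (V-miss n (graft W) (graft-nothing-[] W eq)))
      (≤-trans (avg-mono (sub true) (sub false))
        (≤-trans (≤-reflexive (avg-affine β c _ _)) (affine-mono (avg-V≤V n P))))
    where
    sub : ∀ b → V n (branch b (graft W)) ≤ β + c * V n (branch b P)
    sub b = ≤-trans (≤-reflexive (V-cong n (graft-nothing-∷ W eq b)))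
      (V-graft n (W ∘ (b ∷_)) (branch b P) (λ u → bd (b ∷ u)))

graft-Covers′ : ∀ W B → (∀ u Q → W u ≡ just Q → Covers′ Q (B ↓ u)) →
  ∀ k x {Q} → x ∈ B → W (x ↾ k) ≡ just Q → ∃[ n ] graft W (x ↾ n) ≡ true
graft-Covers′ W B cov k x x∈ stop with W [] in eq
graft-Covers′ W B cov k x x∈ stop | just Q with n , hit ← cov [] Q eq x x∈ =
  n , trans (graft-just W eq (x ↾ n)) hit
graft-Covers′ W B cov zero x x∈ stop | nothing with () ← trans (sym eq) stop
graft-Covers′ W B cov (suc k) x x∈ stop | nothing
  with n , hit ← graft-Covers′ (W ∘ (x 0 ∷_)) (child B (x 0)) (λ u → cov (x 0 ∷ u)) k (x ∘ suc)
                   (tail-∈ B x∈) stop =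
  suc n , trans (graft-nothing-∷ W eq (x 0) _) hit

-- Raising and lowering the outer density along a string.

module _ (em : ExcludedMiddle 0ℓ) where

  by-contradiction : ∀ {P : Set} → ¬ ¬ P → P
  by-contradiction {P} ¬¬p with em {P}
  ... | yes p = p
  ... | no ¬p = ⊥-elim (¬¬p ¬p)

  ¬Dense⇒CoveredWithin : ∀ {j} B → ¬ Dense j B → ∃[ r ] r < 1ℚ - 2^- j × B CoveredWithin r
  ¬Dense⇒CoveredWithin B = by-contradiction

  -- The first string on the way to u at which Dense (suc j) fails still satisfies Dense j.
  dip : ∀ j B u → Dense (suc j) B → ¬ Dense (suc j) (B ↓ u) →
    ∃[ v ] ¬ Dense (suc j) (B ↓ v) × Along (Dense j) B v
  dip j B [] dense sparse = ⊥-elim (sparse dense)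
  dip j B (b ∷ u) dense sparse with em {Dense (suc j) (child B b)}
  ... | no sparse′ = b ∷ [] , sparse′ , Dense-mono j (suc j) B (ℕ.n≤1+n j) dense , Dense-child j B b dense
  ... | yes dense′ with v , sparse′ , along ← dip j (child B b) u dense′ sparse =
    b ∷ v , sparse′ , Dense-mono j (suc j) B (ℕ.n≤1+n j) dense , along

  -- The measure missed at stage `n` is halved by stage `m`. Below a string of length `n` not yet
  -- hit, `P` covers a set of outer density at least 3/4, so finitely many more bits catch at least
  -- half of that cylinder.
  doubling : ∀ n B P → Covers′ P B → (∀ u → Dense 2 (B ↓ u)) →
    ∃[ m ] 1ℚ + V n P ≤ V m P + V m P
  doubling n B P cov dense with P [] in hit
  doubling n B P cov dense | true = 0 , ≤-trans
    (+-mono-≤ {1ℚ} {1ℚ} ≤-refl (V≤1 n P))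
    (≤-reflexive (cong (λ v → v + v) (sym (V-hit 0 P hit))))
  doubling zero B P cov dense | false with em {∃[ m ] ½ ≤ V m P}
  ... | yes (m , ½≤V) = m , ≤-trans (≤-reflexive (cong (λ b → 1ℚ + (if b then 1ℚ else 0ℚ)) hit)) (+-mono-≤ ½≤V ½≤V)
  ... | no ¬½≤V = ⊥-elim (dense [] (½ , ½<¾ , P , cov , λ n → <⇒≤ (≰⇒> (λ ½≤V → ¬½≤V (n , ½≤V)))))
    where
    ½<¾ : ½ < 1ℚ - 2^- 2
    ½<¾ = *<* (ℤ.+<+ (ℕ.s≤s (ℕ.s≤s (ℕ.s≤s (ℕ.s≤s (ℕ.s≤s ℕ.z≤n))))))
  doubling (suc n) B P cov dense | false
    with m₁ , le₁ ← doubling n (child B true) (branch true P) (branch-Covers′ P B true hit cov) (dense ∘ (true ∷_))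
       | m₂ , le₂ ← doubling n (child B false) (branch false P) (branch-Covers′ P B false hit cov) (dense ∘ (false ∷_))
    = suc m , subst₂ (λ p q → 1ℚ + p ≤ q + q) (sym (V-miss n P hit)) (sym (V-miss m P hit))
        (subst₂ _≤_ (avg-translate 1ℚ _ _) (sym (avg-distrib-+ (V m (branch true P)) (V m (branch false P)) _ _))
          (avg-mono (≤-trans le₁ (dbl true m₁ (ℕ.m≤m⊔n m₁ m₂))) (≤-trans le₂ (dbl false m₂ (ℕ.m≤n⊔m m₁ m₂)))))
    where
    m : ℕ
    m = m₁ ℕ.⊔ m₂
    dbl : ∀ b k → k ℕ.≤ m → V k (branch b P) + V k (branch b P) ≤ V m (branch b P) + V m (branch b P)
    dbl b k k≤m = +-mono-≤ (V-mono (branch b P) k≤m) (V-mono (branch b P) k≤m)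

  exhaustion : ∀ k B P → Covers′ P B → (∀ u → Dense 2 (B ↓ u)) → ∃[ n ] 1ℚ ≤ V n P + 2^- k
  exhaustion zero    B P cov dense = 0 , +-mono-≤ {0ℚ} {_} {1ℚ} (V-nonNeg 0 P) ≤-refl
  exhaustion (suc k) B P cov dense
    with n , 1≤ ← exhaustion k B P cov dense
    with m , le ← doubling n B P cov dense
    = m , *-cancelˡ-≤-pos (1ℚ + 1ℚ) (≤-trans (+-monoʳ-≤ 1ℚ 1≤)
        (subst₂ _≤_ (+-assoc 1ℚ (V n P) (2^- k))
          (solve 2 (λ v w → v :+ v :+ w := (con 1ℚ :+ con 1ℚ) :* (v :+ con ½ :* w)) refl (V m P) (2^- k))
          (+-monoˡ-≤ (2^- k) le)))

  -- A weak form of the Lebesgue density theorem: were the outer density at least 3/4 in every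
  -- cylinder, `exhaustion` would bring the measure of the cover above `r`.
  sparse-below : ∀ B {r} → r < 1ℚ → B CoveredWithin r → ∃[ u ] ¬ Dense 2 (B ↓ u)
  sparse-below B {r} r<1 (P , cov , bd) = by-contradiction λ none →
    let k , 2^-k< = 2^-small {1ℚ - r} (subst (_< 1ℚ - r) (+-inverseʳ r) (+-monoˡ-< (- r) r<1))
        n , 1≤ = exhaustion k B P cov (λ u → by-contradiction λ sparse → none (u , sparse))
    in <-irrefl refl (≤-<-trans 1≤ (≤-<-trans (+-monoˡ-≤ (2^- k) (bd n))
         (<-respʳ-≡ (solve 1 (λ r → r :+ (con 1ℚ :- r) := con 1ℚ) refl r) (+-monoʳ-< r 2^-k<))))

  along-or-fails : ∀ (Q : Subset → Set) B x n → Along Q B (x ↾ n) ⊎ ∃[ k ] ¬ Q (B ↓ (x ↾ k))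
  along-or-fails Q B x n with em {Q B}
  along-or-fails Q B x n       | no ¬q = inj₂ (0 , ¬q)
  along-or-fails Q B x zero    | yes q = inj₁ q
  along-or-fails Q B x (suc n) | yes q with along-or-fails Q (child B (x 0)) (x ∘ suc) n
  ... | inj₁ qs       = inj₁ (q , qs)
  ... | inj₂ (k , ¬q) = inj₂ (suc k , ¬q)

  -- Replaces `P` by covers planted along its branches: every branch that meets `P` passes a string
  -- with a local cover, which costs β + c if that string is in `P` and β otherwise.
  refine : ∀ {β c θ} → 0ℚ ≤ β → 0ℚ ≤ c → ∀ B P → Covers′ P B → (∀ n → V n P ≤ θ) →
    (∀ x n → P (x ↾ n) ≡ true →
      ∃[ k ] B ↓ (x ↾ k) CoveredWithin β + c * V 0 (λ v → P ((x ↾ k) ++ v))) →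
    B CoveredWithin β + c * θ
  refine {β} {c} 0≤β 0≤c B P cov bd local = graft W , covG , λ n →
    ≤-trans (V-graft 0≤β 0≤c n W P (λ u Q eq → proj₂ (sound u eq))) (affine-mono 0≤β 0≤c (bd n))
    where
    Local : List Bool → Set
    Local u = B ↓ u CoveredWithin β + c * V 0 (λ v → P (u ++ v))

    W : List Bool → Maybe StringSet
    W u with em {Local u}
    ... | yes (Q , _) = just Q
    ... | no  _       = nothing

    sound : ∀ u {Q} → W u ≡ just Q →
      Covers′ Q (B ↓ u) × (∀ m → V m Q ≤ β + c * V 0 (λ v → P (u ++ v)))
    sound u eq with em {Local u}
    sound u refl | yes (Q , covQ , bdQ) = covQ , bdQ

    complete : ∀ u → Local u → ∃[ Q ] W u ≡ just Q
    complete u loc with em {Local u}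
    ... | yes (Q , _) = Q , refl
    ... | no ¬loc     = ⊥-elim (¬loc loc)

    covG : Covers′ (graft W) B
    covG x x∈ =
      let n , hit = cov x x∈
          k , loc = local x n hit
          _ , stop = complete (x ↾ k) loc
      in graft-Covers′ W B (λ u Q eq → proj₁ (sound u eq)) k x x∈ stop

  module _ (i : ℕ) {θ : ℚ} (0≤θ : 0ℚ ≤ θ) where

    β : ℚ
    β = 1ℚ - 2^- i

    -- Iterating the covers, and stopping wherever Dense i fails, shrinks the part not yet stopped.
    iterate-covers : ∀ k B → (∀ u → Along (Dense i) B u → B ↓ u CoveredWithin θ) →
      B CoveredWithin β + 2^- i * pow θ k
    iterate-covers zero B H = CoveredWithin-weaken B
      (≤-reflexive (solve 1 (λ w → con 1ℚ := con 1ℚ :- w :+ w :* con 1ℚ) refl (2^- i)))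
      (CoveredWithin-1 B)
    iterate-covers (suc k) B H with em {Dense i B}
    ... | no sparse = CoveredWithin-weaken B
      (≤-by _ refl (*-nonNeg (0≤2^- i) (pow-nonNeg (suc k) 0≤θ)))
      (let r , r< , cov = ¬Dense⇒CoveredWithin {i} B sparse in CoveredWithin-weaken B (<⇒≤ r<) cov)
    ... | yes dense with P , cov , bd ← H [] dense =
      CoveredWithin-weaken B
        (≤-reflexive (solve 4 (λ b w p t → b :+ w :* p :* t := b :+ w :* (t :* p)) refl β (2^- i) (pow θ k) θ))
        (refine (1-2^-nonNeg i) (*-nonNeg (0≤2^- i) (pow-nonNeg k 0≤θ)) B P cov bd local)
      where
      c : ℚ
      c = 2^- i * pow θ k

      0≤c : 0ℚ ≤ c
      0≤c = *-nonNeg (0≤2^- i) (pow-nonNeg k 0≤θ)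

      local : ∀ x n → P (x ↾ n) ≡ true →
        ∃[ k ] B ↓ (x ↾ k) CoveredWithin β + c * V 0 (λ v → P ((x ↾ k) ++ v))
      -- On the way to a string of `P`, either `Dense i` fails at a prefix, where a cover of cost β
      -- is at hand, or it persists, and the induction hypothesis at that string gives cost β + c.
      local x n hit with along-or-fails (Dense i) B x n
      ... | inj₂ (m , sparse) = m , (let r , r< , cov = ¬Dense⇒CoveredWithin {i} (B ↓ (x ↾ m)) sparse in
        CoveredWithin-weaken (B ↓ (x ↾ m))
          (≤-trans (<⇒≤ r<) (≤-by _ refl (*-nonNeg 0≤c (V-nonNeg 0 (λ v → P ((x ↾ m) ++ v)))))) cov)
      ... | inj₁ along = n , CoveredWithin-weaken (B ↓ (x ↾ n))
        (≤-reflexive (sym (trans (cong (λ v → β + c * v)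
           (V-hit 0 (λ v → P ((x ↾ n) ++ v)) (trans (cong P (++-identityʳ (x ↾ n))) hit)))
           (cong (β +_) (*-identityʳ c)))))
        (iterate-covers k (B ↓ (x ↾ n)) λ u along′ → subst (_CoveredWithin θ) (↓-++ B (x ↾ n) u)
          (H ((x ↾ n) ++ u) (Along-++ (x ↾ n) u along along′)))

  -- If the target density were never reached while `Dense i` persists, every string reached would
  -- have a cover of measure at most θ = 1 - 2^-j. Iterating until θ^k < 1/2 would cover `B` with
  -- less than 1 - 2^-i + 2^-i / 2 = 1 - 2^-(i+1).
  climb : ∀ i j B → Dense (suc i) B → ∃[ u ] Dense j (B ↓ u) × Along (Dense i) B u
  climb i j B dense = by-contradiction λ none →
    let θ = 1ℚ - 2^- j
        0≤θ = 1-2^-nonNeg j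
        k , small = pow<½ (0<2^- j) 0≤θ
        H : ∀ u → Along (Dense i) B u → B ↓ u CoveredWithin θ
        H u along = let r , r< , cov = ¬Dense⇒CoveredWithin {j} (B ↓ u) (λ d → none (u , d , along))
                    in CoveredWithin-weaken (B ↓ u) (<⇒≤ r<) cov
    in dense (_ , <-respʳ-≡
         (solve 1 (λ w → con 1ℚ :- w :+ w :* con ½ := con 1ℚ :- con ½ :* w) refl (2^- i))
         (+-monoʳ-< (1ℚ - 2^- i) (*-monoʳ-<-pos (2^- i) {{2^-positive i}} small))
       , iterate-covers i 0≤θ k B H)

-- Comparison with μ*

weight : Maybe (List Bool) → ℚ
weight nothing  = 0ℚ
weight (just s) = 2^- (length s)

weight-nonNeg : ∀ m → 0ℚ ≤ weight m
weight-nonNeg nothing  = ≤-refl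
weight-nonNeg (just s) = 0≤2^- (length s)

weightSum : (ℕ → Maybe (List Bool)) → ℕ → ℚ
weightSum c zero    = 0ℚ
weightSum c (suc k) = weightSum c k + weight (c k)

-- Strings outside the half, and the empty string, become `nothing` instead of being removed:
-- indices stay aligned, so the `k`-th sums of both halves compare with the `k`-th sum of the whole.
below : Bool → Maybe (List Bool) → Maybe (List Bool)
below b nothing        = nothing
below b (just [])      = nothing
below b (just (c ∷ u)) = if does (c ≟ b) then just u else nothing

below-just : ∀ b u → below b (just (b ∷ u)) ≡ just u
below-just true  u = refl
below-just false u = refl

weight-below : ∀ m → avg (weight (below true m)) (weight (below false m)) ≤ weight m
weight-below nothing            = avg≤ ≤-refl ≤-refl
weight-below (just [])          = avg≤ 0≤1 0≤1
weight-below (just (true ∷ u))  = ≤-reflexive (avg-0 (2^- (length u)))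
weight-below (just (false ∷ u)) =
  ≤-reflexive (trans (avg-comm 0ℚ (2^- (length u))) (avg-0 (2^- (length u))))

weightSum-below : ∀ c k → avg (weightSum (below true ∘ c) k) (weightSum (below false ∘ c) k) ≤ weightSum c k
weightSum-below c zero    = avg≤ ≤-refl ≤-refl
weightSum-below c (suc k) = ≤-trans (≤-reflexive (sym (avg-distrib-+ _ _ _ _)))
  (+-mono-≤ (weightSum-below c k) (weight-below (c k)))

weightSum-nonNeg : ∀ c k → 0ℚ ≤ weightSum c k
weightSum-nonNeg c zero    = ≤-refl
weightSum-nonNeg c (suc k) = +-nonNeg (weightSum-nonNeg c k) (weight-nonNeg (c k))

weightSum-mono′ : ∀ c {k l} → k ℕ.≤′ l → weightSum c k ≤ weightSum c l
weightSum-mono′ c (ℕ.≤′-reflexive refl) = ≤-refl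
weightSum-mono′ c (ℕ.≤′-step {l} k≤l)   = ≤-trans (weightSum-mono′ c k≤l) (≤-by _ refl (weight-nonNeg (c l)))

-- Subadditivity for a clopen set: at depth `n` only finitely many strings matter, and the larger of
-- the bounds found for the two halves serves for both.
V≤weightSum : ∀ n P c → (∀ u → P u ≡ true → ∃[ i ] c i ≡ just u) → ∃[ k ] V n P ≤ weightSum c k
V≤weightSum n P c listed with P [] in hit
V≤weightSum n P c listed | true with i , eq ← listed [] hit =
  suc i , ≤-trans (V≤1 n P) (≤-by (weightSum c i)
    (trans (+-comm 1ℚ (weightSum c i)) (cong (λ m → weightSum c i + weight m) (sym eq)))
    (weightSum-nonNeg c i))
V≤weightSum zero P c listed | false = 0 , ≤-reflexive (cong (if_then 1ℚ else 0ℚ) hit)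
V≤weightSum (suc n) P c listed | false =
  k , ≤-trans (≤-reflexive (V-miss n P hit))
    (≤-trans (avg-mono (upTo true (ℕ.m≤m⊔n (bound true) (bound false))) (upTo false (ℕ.m≤n⊔m (bound true) (bound false))))
      (weightSum-below c k))
  where
  IH : ∀ b → ∃[ k ] V n (branch b P) ≤ weightSum (below b ∘ c) k
  IH b = V≤weightSum n (branch b P) (below b ∘ c) λ u hit → let i , eq = listed (b ∷ u) hit in
    i , trans (cong (below b) eq) (below-just b u)
  bound : Bool → ℕ
  bound b = proj₁ (IH b)
  k : ℕ
  k = bound true ℕ.⊔ bound false
  upTo : ∀ b → bound b ℕ.≤ k → V n (branch b P) ≤ weightSum (below b ∘ c) k
  upTo b le = ≤-trans (proj₂ (IH b)) (weightSum-mono′ (below b ∘ c) (ℕ.≤⇒≤′ le))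

weightSum-just : ∀ c k → weightSum (just ∘ c) k ≡ partialSum c k
weightSum-just c zero    = refl
weightSum-just c (suc k) = cong (_+ 2^- (length (c k))) (weightSum-just c k)

-- From sets of strings to sequences of cylinders.

total : List (List Bool) → ℚ
total []       = 0ℚ
total (s ∷ ss) = 2^- (length s) + total ss

total-nonNeg : ∀ ss → 0ℚ ≤ total ss
total-nonNeg []       = ≤-refl
total-nonNeg (s ∷ ss) = +-nonNeg (0≤2^- (length s)) (total-nonNeg ss)

total-++ : ∀ ss ts → total (ss ++ ts) ≡ total ss + total ts
total-++ []       ts = sym (+-identityˡ (total ts))
total-++ (s ∷ ss) ts = trans (cong (2^- (length s) +_) (total-++ ss ts)) (sym (+-assoc (2^- (length s)) _ _))

total-map-∷ : ∀ b ss → total (map (b ∷_) ss) ≡ ½ * total ss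
total-map-∷ b []       = sym (*-zeroʳ ½)
total-map-∷ b (s ∷ ss) = trans (cong (λ t → ½ * 2^- (length s) + t) (total-map-∷ b ss))
  (sym (*-distribˡ-+ ½ (2^- (length s)) (total ss)))

Sum : (ℕ → ℚ) → ℕ → ℚ
Sum f zero    = 0ℚ
Sum f (suc k) = f 0 + Sum (f ∘ suc) k

Sum-cong : ∀ {f g} → f ≗ g → ∀ k → Sum f k ≡ Sum g k
Sum-cong f≗g zero    = refl
Sum-cong f≗g (suc k) = cong₂ _+_ (f≗g 0) (Sum-cong (f≗g ∘ suc) k)

Sum-0 : ∀ k → Sum (λ _ → 0ℚ) k ≡ 0ℚ
Sum-0 zero    = refl
Sum-0 (suc k) = trans (+-identityˡ _) (Sum-0 k)

Sum-+ : ∀ f g k → Sum (λ j → f j + g j) k ≡ Sum f k + Sum g k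
Sum-+ f g zero    = refl
Sum-+ f g (suc k) = trans (cong (λ t → f 0 + g 0 + t) (Sum-+ (f ∘ suc) (g ∘ suc) k))
  (solve 4 (λ a b c d → a :+ b :+ (c :+ d) := a :+ c :+ (b :+ d)) refl (f 0) (g 0) _ _)

Sum-avg : ∀ f g k → Sum (λ j → avg (f j) (g j)) k ≡ avg (Sum f k) (Sum g k)
Sum-avg f g zero    = sym (avg-idem 0ℚ)
Sum-avg f g (suc k) = trans (cong (avg (f 0) (g 0) +_) (Sum-avg (f ∘ suc) (g ∘ suc) k))
  (avg-distrib-+ (f 0) (g 0) _ _)

Sum-suc≤ : ∀ f k → (∀ j → 0ℚ ≤ f j) → Sum f k ≤ Sum f (suc k)
Sum-suc≤ f zero    0≤f = +-nonNeg (0≤f 0) ≤-refl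
Sum-suc≤ f (suc k) 0≤f = +-monoʳ-≤ (f 0) (Sum-suc≤ (f ∘ suc) k (0≤f ∘ suc))

-- The minimal elements of P, level by level.
firstHits : StringSet → ℕ → List (List Bool)
firstHits P zero    = if P [] then [] ∷ [] else []
firstHits P (suc n) = if P [] then [] else
  map (true ∷_) (firstHits (branch true P) n) ++ map (false ∷_) (firstHits (branch false P) n)

total-branches : ∀ ss ts → total (map (true ∷_) ss ++ map (false ∷_) ts) ≡ avg (total ss) (total ts)
total-branches ss ts = trans (total-++ (map (true ∷_) ss) (map (false ∷_) ts))
  (trans (cong₂ _+_ (total-map-∷ true ss) (total-map-∷ false ts)) (½-+-½ (total ss) (total ts)))

-- Distinct minimal strings have disjoint cylinders, so their weights add up to no more than the
-- measure of the union.
Sum-firstHits : ∀ n P → Sum (total ∘ firstHits P) (suc n) ≤ V n P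
Sum-firstHits n P with P [] in hit
Sum-firstHits n P | true = ≤-reflexive
  (trans (cong (λ t → 1ℚ + 0ℚ + t) (Sum-0 n)) (sym (V-hit n P hit)))
Sum-firstHits zero P | false = V-nonNeg 0 P
Sum-firstHits (suc n) P | false = ≤-trans
  (≤-reflexive (trans (+-identityˡ _)
    (trans (Sum-cong (λ j → total-branches (firstHits (branch true P) j) (firstHits (branch false P) j)) (suc n))
      (Sum-avg (total ∘ firstHits (branch true P)) (total ∘ firstHits (branch false P)) (suc n)))))
  (≤-trans (avg-mono (Sum-firstHits n (branch true P)) (Sum-firstHits n (branch false P)))
    (≤-reflexive (sym (V-miss n P hit))))

firstHits-∋ : ∀ n P x → P (x ↾ n) ≡ true → ∃[ j ] Any (x ↾ j ≡_) (firstHits P j)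
firstHits-∋ n P x hit with P [] in eq
firstHits-∋ n P x hit | true =
  0 , subst (λ b → Any ([] ≡_) (if b then [] ∷ [] else [])) (sym eq) (here refl)
firstHits-∋ zero P x hit | false with () ← trans (sym eq) hit
firstHits-∋ (suc n) P x hit | false with j , any ← firstHits-∋ n (branch (x 0) P) (x ∘ suc) hit =
  suc j , subst (λ b → Any (x ↾ suc j ≡_) (if b then [] else map (true ∷_) (firstHits (branch true P) j)
      ++ map (false ∷_) (firstHits (branch false P) j)))
    (sym eq) (locate (x 0) any)
  where
  locate : ∀ b {s} → Any (s ≡_) (firstHits (branch b P) j) → Any (b ∷ s ≡_)
    (map (true ∷_) (firstHits (branch true P) j) ++ map (false ∷_) (firstHits (branch false P) j))
  locate true  any = Any.++⁺ˡ (Any.map⁺ (Any.map (cong (true ∷_)) any))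
  locate false any = Any.++⁺ʳ _ (Any.map⁺ (Any.map (cong (false ∷_)) any))

-- Concatenates ss and the lists L 0, L 1, …, separated by the strings F 0, F 1, …; the
-- separators keep the sequence infinite when the lists run empty.
interleave : List (List Bool) → (ℕ → List Bool) → (ℕ → List (List Bool)) → ℕ → List Bool
interleave []       F L zero    = F 0
interleave []       F L (suc i) = interleave (L 0) (F ∘ suc) (L ∘ suc) i
interleave (s ∷ ss) F L zero    = s
interleave (s ∷ ss) F L (suc i) = interleave ss F L i

interleave-skip : ∀ ss F L {s} → ∃[ i ] interleave [] F L i ≡ s → ∃[ i ] interleave ss F L i ≡ s
interleave-skip []       F L found = found
interleave-skip (t ∷ ss) F L found = let i , eq = interleave-skip ss F L found in suc i , eq

interleave-∋ˡ : ∀ ss F L {s} → Any (s ≡_) ss → ∃[ i ] interleave ss F L i ≡ s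
interleave-∋ˡ (t ∷ ss) F L (here s≡t)  = 0 , sym s≡t
interleave-∋ˡ (t ∷ ss) F L (there any) = let i , eq = interleave-∋ˡ ss F L any in suc i , eq

interleave-∋ : ∀ j F L {s} → Any (s ≡_) (L j) → ∃[ i ] interleave [] F L i ≡ s
interleave-∋ zero    F L any =
  let i , eq = interleave-∋ˡ (L 0) (F ∘ suc) (L ∘ suc) any in suc i , eq
interleave-∋ (suc j) F L any =
  let i , eq = interleave-skip (L 0) (F ∘ suc) (L ∘ suc) (interleave-∋ j (F ∘ suc) (L ∘ suc) any) in suc i , eq

partialSum-suc : ∀ c n → partialSum c (suc n) ≡ 2^- (length (c 0)) + partialSum (c ∘ suc) n
partialSum-suc c zero    = +-comm 0ℚ (2^- (length (c 0)))
partialSum-suc c (suc n) = trans (cong (_+ 2^- (length (c (suc n)))) (partialSum-suc c n))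
  (+-assoc (2^- (length (c 0))) _ _)

partialSum-interleave : ∀ k ss F L →
  partialSum (interleave ss F L) k ≤ total ss + Sum (λ j → 2^- (length (F j)) + total (L j)) k
partialSum-interleave zero    ss F L = +-nonNeg (total-nonNeg ss) ≤-refl
partialSum-interleave (suc k) [] F L = ≤-trans
  (≤-reflexive (partialSum-suc (interleave [] F L) k))
  (≤-trans (+-monoʳ-≤ (2^- (length (F 0))) (partialSum-interleave k (L 0) (F ∘ suc) (L ∘ suc)))
    (≤-reflexive (solve 3 (λ a b c → a :+ (b :+ c) := con 0ℚ :+ (a :+ b :+ c)) refl
      (2^- (length (F 0))) (total (L 0)) _)))
partialSum-interleave (suc k) (s ∷ ss) F L = ≤-trans
  (≤-reflexive (partialSum-suc (interleave (s ∷ ss) F L) k))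
  (≤-trans (+-monoʳ-≤ (2^- (length s))
      (≤-trans (partialSum-interleave k ss F L)
        (+-monoʳ-≤ (total ss) (Sum-suc≤ _ k λ j → +-nonNeg (0≤2^- (length (F j))) (total-nonNeg (L j))))))
    (≤-reflexive (sym (+-assoc (2^- (length s)) _ _))))

-- Separators of lengths K+1, K+2, and so on: their total weight is at most `2^- K`, hence as small
-- as desired.
filler : ℕ → ℕ → List Bool
filler K zero    = replicate (suc K) true
filler K (suc j) = filler (suc K) j

Sum-filler : ∀ K k → Sum (λ j → 2^- (length (filler K j))) k ≤ 2^- K
Sum-filler K zero    = 0≤2^- K
Sum-filler K (suc k) = ≤-trans
  (+-mono-≤ (≤-reflexive (cong (λ n → ½ * 2^- n) (length-replicate K))) (Sum-filler (suc K) k))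
  (≤-reflexive (2^-halves K))

CoveredWithin⇒μ*-upper : ∀ B {r q} → r < q → B CoveredWithin r → upper (μ* B) q
CoveredWithin⇒μ*-upper B {r} {q} r<q (P , cov , bd)
  with K , 2^-K< ← 2^-small {q - r} (subst (_< q - r) (+-inverseʳ r) (+-monoˡ-< (- r) r<q))
  = c , covers , 2^- K + r
  , <-respʳ-≡ (solve 2 (λ q r → q :- r :+ r := q) refl q r) (+-monoˡ-< r 2^-K<)
  , sums
  where
  c : ℕ → List Bool
  c = interleave [] (filler K) (firstHits P)

  covers : Covers c B
  covers x x∈ with n , hit ← cov x x∈ with j , any ← firstHits-∋ n P x hit
    with i , eq ← interleave-∋ j (filler K) (firstHits P) any =
    i , trans (cong (x ↾_) (trans (cong length eq) (length-applyUpTo x j))) (sym eq)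

  sums : ∀ n → partialSum c n ≤ 2^- K + r
  sums n = ≤-trans (partialSum-interleave n [] (filler K) (firstHits P))
    (≤-trans (≤-reflexive (trans (+-identityˡ _) (Sum-+ _ (total ∘ firstHits P) n)))
      (+-mono-≤ (Sum-filler K n)
        (≤-trans (Sum-suc≤ (total ∘ firstHits P) n (total-nonNeg ∘ firstHits P)) (≤-trans (Sum-firstHits n P) (bd n)))))

∩N-CoveredWithin⇒ : ∀ s B {q r} → r < q * 2^- (length s) → B ∩ N s CoveredWithin r →
  ∃[ r′ ] r′ < q × B ↓ s CoveredWithin r′
∩N-CoveredWithin⇒ [] B {q} {r} r< cov =
  r , <-respʳ-≡ (*-identityʳ q) r< , CoveredWithin-antitone {B} {B ∩ N []} (λ x∈ → x∈ , refl) cov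
∩N-CoveredWithin⇒ (b ∷ s) B {q} {r} r< (P , cov , bd) =
  ∩N-CoveredWithin⇒ s (child B b) r+r< within
  where
  w = 2^- (length s)

  r+r< : r + r < q * w
  r+r< = <-respʳ-≡
    (solve 2 (λ q w → q :* (con ½ :* w) :+ q :* (con ½ :* w) := q :* w) refl q w) (+-mono-< r< r<)

  within : child B b ∩ N s CoveredWithin r + r
  within with P [] in hit
  -- If `P` contains the empty string then r ≥ 1 already, and the whole space is a cover within r +
  -- r.
  ... | true = CoveredWithin-weaken (child B b ∩ N s)
    (≤-trans 1≤r (≤-by r refl (≤-trans 0≤1 1≤r))) (CoveredWithin-1 (child B b ∩ N s))
    where
    1≤r : 1ℚ ≤ r
    1≤r = ≤-trans (≤-reflexive (sym (V-hit 0 P hit))) (bd 0)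
  ... | false = CoveredWithin-antitone {child B b ∩ N s} {child (B ∩ N (b ∷ s)) b}
    (λ (x∈B , x∈N) → x∈B , cong (b ∷_) x∈N)
    (branch b P , branch-Covers′ P (B ∩ N (b ∷ s)) b hit cov
    , λ n → ≤-trans (V-branch n P b) (+-mono-≤ (bd (suc n)) (bd (suc n))))

∩N-CoveredWithin⇐ : ∀ s B {q r} → r < q → B ↓ s CoveredWithin r →
  ∃[ r′ ] r′ < q * 2^- (length s) × B ∩ N s CoveredWithin r′
∩N-CoveredWithin⇐ [] B {q} {r} r< cov =
  r , <-respʳ-≡ (sym (*-identityʳ q)) r< , CoveredWithin-antitone {B ∩ N []} {B} proj₁ cov
∩N-CoveredWithin⇐ (b ∷ s) B {q} r< cov
  with r′ , r′< , P , covP , bd ← ∩N-CoveredWithin⇐ s (child B b) {q} r< cov =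
  ½ * r′
  , <-respʳ-≡ (solve 2 (λ q w → con ½ :* (q :* w) := q :* (con ½ :* w)) refl q (2^- (length s)))
      (*-monoʳ-<-pos ½ r′<)
  , splice b P (λ _ → false)
  , (λ { x (x∈B , x∈N) → splice-hit b P (λ _ → false) (B ∩ N (b ∷ s))
           (λ y (y∈B , y∈N) → covP y (y∈B , ∷-injectiveʳ y∈N)) x (x∈B , x∈N) (∷-injectiveˡ x∈N) })
  , λ n → ≤-trans (V-splice≤ b P (λ _ → false) bd V-∅ n) (≤-reflexive (avg-0 r′))

module _ (em : ExcludedMiddle 0ℓ) where

  μ*-upper⇒CoveredWithin : ∀ B {q} → upper (μ* B) q → ∃[ r ] r < q × B CoveredWithin r
  μ*-upper⇒CoveredWithin B (c , cov , r , r<q , sums) = r , r<q , P , covers , λ n →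
    let k , V≤ = V≤weightSum n P (just ∘ c) listed
    in ≤-trans V≤ (≤-trans (≤-reflexive (weightSum-just c k)) (sums k))
    where
    P : StringSet
    P u = does (em {∃[ i ] c i ≡ u})

    listed : ∀ u → P u ≡ true → ∃[ i ] just (c i) ≡ just u
    listed u hit with em {∃[ i ] c i ≡ u}
    ... | yes (i , eq) = i , cong just eq

    covers : Covers′ P B
    covers x x∈ = let i , x∈N = cov x x∈ in
      length (c i) , dec-true (em {∃[ j ] c j ≡ x ↾ length (c i)}) (i , sym x∈N)

  density-upper : ∀ A s q → upper (density A s) q ⇔ (∃[ r ] r < q × A ↓ s CoveredWithin r)
  density-upper A s q = mk⇔
    (λ up → let r , r< , cov = μ*-upper⇒CoveredWithin (A ∩ N s) up in ∩N-CoveredWithin⇒ s A r< cov)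
    (λ (r , r< , cov) → let r′ , r′< , cov′ = ∩N-CoveredWithin⇐ s A {q} r< cov
      in CoveredWithin⇒μ*-upper (A ∩ N s) r′< cov′)

-- Density points and the reduction

∈N-↾ : ∀ x n → x ∈ N (x ↾ n)
∈N-↾ x n = cong (x ↾_) (length-applyUpTo x n)

∈N-↾⇒≡ : ∀ {x y} n → y ∈ N (x ↾ n) → y ↾ n ≡ x ↾ n
∈N-↾⇒≡ {x} {y} n = subst (λ k → y ↾ k ≡ x ↾ n) (length-applyUpTo x n)

↾-restrict : ∀ {x y} {m n} → m ℕ.≤ n → x ↾ n ≡ y ↾ n → x ↾ m ≡ y ↾ m
↾-restrict ℕ.z≤n       eq = refl
↾-restrict (ℕ.s≤s m≤n) eq = cong₂ _∷_ (∷-injectiveˡ eq) (↾-restrict m≤n (∷-injectiveʳ eq))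

↾-ext : ∀ {x y} n → (∀ {i} → i ℕ.< n → x i ≡ y i) → x ↾ n ≡ y ↾ n
↾-ext zero    eq = refl
↾-ext (suc n) eq = cong₂ _∷_ (eq (ℕ.s≤s ℕ.z≤n)) (↾-ext n (eq ∘ ℕ.s≤s))

↾-extends : ∀ t x {n} → x ∈ N t → length t ℕ.≤ n → ∃[ u ] x ↾ n ≡ t ++ u
↾-extends []      x {n} x∈ le = x ↾ n , refl
↾-extends (b ∷ t) x {suc n} x∈ (ℕ.s≤s le)
  with u , eq ← ↾-extends t (x ∘ suc) {n} (∷-injectiveʳ x∈) le =
  u , cong₂ _∷_ (∷-injectiveˡ x∈) eq

take-++ : ∀ n (s u : List Bool) → take n (s ++ u) ≡ take n s ++ take (n ℕ.∸ length s) u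
take-++ n       []      u = cong (_++ take n u) (sym (take-[] n))
take-++ zero    (b ∷ s) u = refl
take-++ (suc n) (b ∷ s) u = cong (b ∷_) (take-++ n s u)

pad : List Bool → 2^ω
pad []      n       = false
pad (b ∷ s) zero    = b
pad (b ∷ s) (suc n) = pad s n

pad-∈N : ∀ s → pad s ∈ N s
pad-∈N []      = refl
pad-∈N (b ∷ s) = cong (b ∷_) (pad-∈N s)

pad-++ : ∀ s u {n} → n ℕ.< length s → pad (s ++ u) n ≡ pad s n
pad-++ (b ∷ s) u {zero}  n< = refl
pad-++ (b ∷ s) u {suc n} n< = pad-++ s u (ℕ.s≤s⁻¹ n<)

pad-↾ : ∀ s n → n ℕ.≤ length s → pad s ↾ n ≡ take n s
pad-↾ s       zero    n≤ = refl
pad-↾ (b ∷ s) (suc n) n≤ = cong (b ∷_) (pad-↾ s n (ℕ.s≤s⁻¹ n≤))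

Along-last : ∀ {Q B} u → Along Q B u → Q (B ↓ u)
Along-last []      q        = q
Along-last (b ∷ u) (_ , qs) = Along-last u qs

EventuallyAbove : (ℕ → ℕ) → Set
EventuallyAbove a = ∀ l → ∃[ K ] ∀ k → K ℕ.≤ k → l ℕ.≤ a k

least : (ℕ → Bool) → ℕ → ℕ
least p zero    = 0
least p (suc b) = if p 0 then 0 else suc (least (p ∘ suc) b)

least≤ : ∀ p b i → p i ≡ true → least p b ℕ.≤ i
least≤ p zero    i hit = ℕ.z≤n
least≤ p (suc b) i hit with p 0 in eq
least≤ p (suc b) i hit       | true  = ℕ.z≤n
least≤ p (suc b) zero hit    | false with () ← trans (sym eq) hit
least≤ p (suc b) (suc i) hit | false = ℕ.s≤s (least≤ (p ∘ suc) b i hit)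

≤least : ∀ p {b l} → l ℕ.≤ b → (∀ {i} → i ℕ.< l → p i ≡ false) → l ℕ.≤ least p b
≤least p ℕ.z≤n       miss = ℕ.z≤n
≤least p (ℕ.s≤s l≤b) miss rewrite miss (ℕ.s≤s ℕ.z≤n) = ℕ.s≤s (≤least (p ∘ suc) l≤b (miss ∘ ℕ.s≤s))

least-cong : ∀ {p q} b → p ≗ q → least p b ≡ least q b
least-cong zero    p≗q = refl
least-cong {p} {q} (suc b) p≗q rewrite p≗q 0 | least-cong {p ∘ suc} {q ∘ suc} b (p≗q ∘ suc) = refl

eventually-all : ∀ {Q : ℕ → ℕ → Set} l → (∀ m → ∃[ K ] ∀ k → K ℕ.≤ k → Q m k) →
  ∃[ K ] ∀ k → K ℕ.≤ k → ∀ {m} → m ℕ.< l → Q m k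
eventually-all zero    ev = 0 , λ _ _ ()
eventually-all {Q} (suc l) ev
  with K₀ , H₀ ← ev 0 | K₁ , H₁ ← eventually-all {Q ∘ suc} l (ev ∘ suc) =
  K₀ ℕ.⊔ K₁ , λ where
    k K≤k {zero}  m<l         → H₀ k (ℕ.≤-trans (ℕ.m≤m⊔n K₀ K₁) K≤k)
    k K≤k {suc m} (ℕ.s≤s m<l) → H₁ k (ℕ.≤-trans (ℕ.m≤n⊔m K₀ K₁) K≤k) m<l

module _ (em : ExcludedMiddle 0ℓ) where

  -- Covering everything shows that the density never exceeds 1, so convergence to 1 restricts it
  -- only from below.
  density<1+ε : ∀ A s {ε} → 0ℚ < ε → density A s <ℝ fromℚ 1ℚ +ℝ fromℚ ε
  density<1+ε A s {ε} 0<ε = 1ℚ + ε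
    , from (density-upper em A s (1ℚ + ε))
        (1ℚ , <-respˡ-≡ (+-identityʳ 1ℚ) (+-monoʳ-< 1ℚ 0<ε) , CoveredWithin-1 (A ↓ s))
    , λ (p , q , 1<p , ε<q , le) → <-irrefl refl (<-≤-trans (+-mono-< 1<p ε<q) le)

  Dense⇒1<density+ε : ∀ A s {l ε} → 2^- l < ε → Dense l (A ↓ s) → fromℚ 1ℚ <ℝ density A s +ℝ fromℚ ε
  -- The witness exceeds 1 because w < ε, and a density of at least 1 - w keeps it out of the upper
  -- cut of the sum.
  Dense⇒1<density+ε A s {l} {ε} w<ε dense = 1ℚ + (ε - w)
    , <-respˡ-≡ (+-identityʳ 1ℚ) (+-monoʳ-< 1ℚ (<-respˡ-≡ (+-inverseʳ w) (+-monoˡ-< (- w) w<ε)))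
    , λ (p , q , up , ε<q , le) →
        let r , r<p , cov = to (density-upper em A s p) up
            p≤ = ≮⇒≥ λ 1-w<p → <-irrefl refl (<-≤-trans (+-mono-< 1-w<p ε<q)
                   (≤-trans le (≤-reflexive (solve 2 (λ w e → con 1ℚ :+ (e :- w) := con 1ℚ :- w :+ e) refl w ε))))
        in dense (r , <-≤-trans r<p p≤ , cov)
    where w = 2^- l

  1<density+⇒Dense : ∀ A s l → fromℚ 1ℚ <ℝ density A s +ℝ fromℚ (2^- l) → Dense l (A ↓ s)
  1<density+⇒Dense A s l (q , 1<q , notUp) dense = notUp
    ( 1ℚ - w , w + (q - 1ℚ) , from (density-upper em A s (1ℚ - w)) dense
    , <-respˡ-≡ (+-identityʳ w) (+-monoʳ-< w (<-respˡ-≡ (+-inverseʳ 1ℚ) (+-monoˡ-< (- 1ℚ) 1<q)))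
    , ≤-reflexive (solve 2 (λ w q → con 1ℚ :- w :+ (w :+ (q :- con 1ℚ)) := q) refl w q))
    where w = 2^- l

  ∈Φ⇒Dense : ∀ A {x} → x ∈ Φ A → ∀ l → ∃[ M ] ∀ n → M ℕ.≤ n → Dense l (A ↓ (x ↾ n))
  ∈Φ⇒Dense A {x} lim l = let M , H = lim (2^- l) (0<2^- l) in
    M , λ n M≤n → 1<density+⇒Dense A (x ↾ n) l (proj₂ (H n M≤n))

  Dense⇒∈Φ : ∀ A x → (∀ l → ∃[ M ] ∀ n → M ℕ.≤ n → Dense l (A ↓ (x ↾ n))) → x ∈ Φ A
  Dense⇒∈Φ A x dense ε 0<ε = let l , w<ε = 2^-small 0<ε ; M , H = dense l in
    M , λ n M≤n → density<1+ε A (x ↾ n) 0<ε , Dense⇒1<density+ε A (x ↾ n) {l} w<ε (H n M≤n)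

  Φ-Π⁰₃ : ∀ A → Π⁰₃ (Φ A)
  Φ-Π⁰₃ A = F , closed , λ x → mk⇔ (∈Φ⇒Dense A) (Dense⇒∈Φ A x)
    where
    F : ℕ → ℕ → Subset
    F l M = record
      { pred = λ x → ∀ n → M ℕ.≤ n → Dense l (A ↓ (x ↾ n))
      ; resp = λ x≗y H n M≤n → subst (λ s → Dense l (A ↓ s)) (↾-cong x≗y n) (H n M≤n)
      }

    closed : ∀ l M → Closed (F l M)
    closed l M {x} x∉F with em {∃[ n ] M ℕ.≤ n × ¬ Dense l (A ↓ (x ↾ n))}
    -- A failure at length `n` is read off from `x ↾ n`, so it persists on the whole cylinder.
    ... | yes (n , M≤n , sparse) = x ↾ n , ∈N-↾ x n , λ {y} y∈N y∈F →
      sparse (subst (λ s → Dense l (A ↓ s)) (∈N-↾⇒≡ {x} {y} n y∈N) (y∈F n M≤n))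
    ... | no none = ⊥-elim (x∉F λ n M≤n → by-contradiction em λ sparse → none (n , M≤n , sparse))

  -- Playing a sequence of naturals along a branch.

  module _ (A : Subset) (empty : Empty (interior (Φ A))) where

    -- If every cylinder inside `N t` had outer density 1, all points of `N t` would lie in `Φ A`,
    -- against the empty interior. Below a cylinder of smaller density, `sparse-below` applies.
    sparse-extension : ∀ t → ∃[ u ] ¬ Dense 2 (A ↓ t ↓ u)
    sparse-extension t with em {∃[ u ] ∃[ r ] r < 1ℚ × A ↓ (t ++ u) CoveredWithin r}
    ... | yes (u , r , r<1 , cov) =
      let v , sparse = sparse-below em (A ↓ (t ++ u)) r<1 cov in
      u ++ v , λ dense → sparse (subst (λ B → Dense 2 (B ↓ v)) (sym (↓-++ A t u)) (Dense-++⁻ 2 (A ↓ t) u v dense))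
    ... | no none = ⊥-elim (empty (pad t) (t , pad-∈N t , λ {x} x∈N → Dense⇒∈Φ A x
      λ l → length t , λ n t≤n (r , r< , cov) →
        let u , eq = ↾-extends t x x∈N t≤n
        in none (u , r , <-≤-trans r< (1-2^-≤1 l) , subst (λ s → A ↓ s CoveredWithin r) eq cov)))

    -- `level` is the number last played, or 0 in `denseState`. The density invariant is one level
    -- higher because `climb` gives up one level on its way.
    record State : Set where
      constructor state
      field
        string : List Bool
        level  : ℕ
        dense  : Dense (suc level) (A ↓ string)

    open State

    denseState : ∀ {x} → ∃[ M ] (∀ n → M ℕ.≤ n → Dense 1 (A ↓ (x ↾ n))) → State
    denseState {x} (M , H) = state (x ↾ M) 0 (H M ℕ.≤-refl)

    opaque
      -- `climb` reaches density 1 - 2^-(a+2); `dip` then heads for a sparse extension and stops at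
      -- the first string below that density. The climb keeps `Dense` at the old level and the dip
      -- at a+1, so both keep it at every `l` up to the old and the new number. The dip is nonempty,
      -- hence the string grows.
      stage : (σ : State) (a : ℕ) → let B = A ↓ string σ in ∃[ u ]
        0 ℕ.< length u × ¬ Dense (2 ℕ.+ a) (B ↓ u) × Dense (suc a) (B ↓ u) ×
        (∀ l → l ℕ.≤ level σ → l ℕ.≤ a → Along (Dense l) B u)
      stage (state t a′ dense) a =
        let u , denseᵤ , alongᵤ = climb em a′ (2 ℕ.+ a) (A ↓ t) dense
            w , sparseʷ = sparse-extension (t ++ u)
            v , sparseᵥ , alongᵥ = dip em (suc a) (A ↓ t ↓ u) w denseᵤ (sparser u w sparseʷ)
        in u ++ v , 0<length u v denseᵤ sparseᵥ
        , (λ d → sparseᵥ (Dense-++⁻ (2 ℕ.+ a) (A ↓ t) u v d))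
        , Dense-++⁺ (suc a) (A ↓ t) u v (Along-last v alongᵥ)
        , λ l l≤a′ l≤a → Along-++ u v
            (Along-map u (λ {C} → Dense-mono l a′ C l≤a′) alongᵤ)
            (Along-map v (λ {C} → Dense-mono l (suc a) C (ℕ.m≤n⇒m≤1+n l≤a)) alongᵥ)
        where
        sparser : ∀ u w → ¬ Dense 2 (A ↓ (t ++ u) ↓ w) → ¬ Dense (2 ℕ.+ a) (A ↓ t ↓ u ↓ w)
        sparser u w sparse d = sparse (subst (λ B → Dense 2 (B ↓ w)) (sym (↓-++ A t u))
          (Dense-mono 2 (2 ℕ.+ a) (A ↓ t ↓ u ↓ w) (ℕ.s≤s (ℕ.s≤s ℕ.z≤n)) d))

        0<length : ∀ u v → Dense (2 ℕ.+ a) (A ↓ t ↓ u) → ¬ Dense (2 ℕ.+ a) (A ↓ t ↓ u ↓ v) → 0 ℕ.< length (u ++ v)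
        0<length u []      dense sparse = ⊥-elim (sparse dense)
        0<length u (b ∷ v) dense sparse = ℕ.≤-trans (ℕ.≤-trans (ℕ.s≤s ℕ.z≤n) (ℕ.m≤n+m (suc (length v)) (length u)))
          (ℕ.≤-reflexive (sym (length-++ u)))

    next : State → ℕ → State
    next σ a = let u , _ , _ , dense , _ = stage σ a in
      state (string σ ++ u) a (Dense-++⁺ (suc a) A (string σ) u dense)

    module _ (start : State) where

      play : (ℕ → ℕ) → ℕ → State
      play a zero    = start
      play a (suc k) = next (play a k) (a k)

      play-cong : ∀ {a b} k → (∀ {i} → i ℕ.< k → a i ≡ b i) → play a k ≡ play b k
      play-cong zero    eq = refl
      play-cong {a} {b} (suc k) eq =
        cong₂ next (play-cong {a} {b} k (λ i<k → eq (ℕ.m<n⇒m<1+n i<k))) (eq ℕ.≤-refl)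

      module _ (a : ℕ → ℕ) where

        position : ℕ → List Bool
        position k = string (play a k)

        move : ℕ → List Bool
        move k = proj₁ (stage (play a k) (a k))

        k≤length-position : ∀ k → k ℕ.≤ length (position k)
        k≤length-position zero    = ℕ.z≤n
        k≤length-position (suc k) = ℕ.≤-trans
          (ℕ.≤-trans (ℕ.≤-reflexive (ℕ.+-comm 1 k))
            (ℕ.+-mono-≤ (k≤length-position k) (proj₁ (proj₂ (stage (play a k) (a k))))))
          (ℕ.≤-reflexive (sym (length-++ (position k))))

        position-extends : ∀ {k l} → k ℕ.≤′ l → ∀ {n} → n ℕ.< length (position k) → pad (position l) n ≡ pad (position k) n
        position-extends (ℕ.≤′-reflexive refl) n< = refl
        position-extends {k} (ℕ.≤′-step {l} k≤l) n< = trans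
          (pad-++ (position l) (move l) (ℕ.<-≤-trans n< (length-mono k≤l)))
          (position-extends k≤l n<)
          where
          length-mono : ∀ {l} → k ℕ.≤′ l → length (position k) ℕ.≤ length (position l)
          length-mono (ℕ.≤′-reflexive refl) = ℕ.≤-refl
          length-mono (ℕ.≤′-step {l} k≤l) = ℕ.≤-trans (length-mono k≤l)
            (ℕ.≤-trans (ℕ.m≤m+n _ _) (ℕ.≤-reflexive (sym (length-++ (position l)))))

      opaque
        -- Each move adds a bit, so after n+1 moves bit `n` is final and the padding is never seen.
        -- Stopping at n+1 moves makes bit `n` depend on `a 0`, ..., `a n` only.
        outcome : (ℕ → ℕ) → 2^ω
        outcome a n = pad (position a (suc n)) n

        outcome-cong : ∀ a b n → (∀ {i} → i ℕ.≤ n → a i ≡ b i) → outcome a n ≡ outcome b n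
        outcome-cong a b n eq = cong (λ σ → pad (string σ) n) (play-cong {a} {b} (suc n) (λ i<1+n → eq (ℕ.s≤s⁻¹ i<1+n)))

        outcome-↾ : ∀ a k n → n ℕ.≤ length (position a k) → outcome a ↾ n ≡ take n (position a k)
        outcome-↾ a k n n≤ = trans (↾-ext n λ i<n → agree (ℕ.<-≤-trans i<n n≤)) (pad-↾ (position a k) n n≤)
          where
          agree : ∀ {i} → i ℕ.< length (position a k) → outcome a i ≡ pad (position a k) i
          agree {i} i< with ℕ.≤-total k (suc i)
          ... | inj₁ k≤ = position-extends a {k} {suc i} (ℕ.≤⇒≤′ k≤) i<
          ... | inj₂ ≤k = sym (position-extends a {suc i} {k} (ℕ.≤⇒≤′ ≤k) (k≤length-position a (suc i)))

      -- A prefix at least as long as the position at `K` either lies within an earlier position or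
      -- ends inside the last move, where `Along` applies.
      Dense-prefixes : ∀ a l K → (∀ k → K ℕ.≤ k → Along (Dense l) (A ↓ position a k) (move a k)) →
        ∀ j n → length (position a K) ℕ.≤ n → Dense l (A ↓ take n (position a (j ℕ.+ K)))
      Dense-prefixes a l K along zero n ≤n = subst (λ s → Dense l (A ↓ s))
        (sym (take-all n (position a K) ≤n)) (Along-head (move a K) (along K ℕ.≤-refl))
      Dense-prefixes a l K along (suc j) n ≤n with ℕ.≤-total n (length (position a (j ℕ.+ K)))
      ... | inj₁ n≤ = subst (λ s → Dense l (A ↓ s))
        (sym (trans (take-++ n (position a (j ℕ.+ K)) _)
          (trans (cong (λ i → take n (position a (j ℕ.+ K)) ++ take i (move a (j ℕ.+ K))) (ℕ.m≤n⇒m∸n≡0 n≤))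
            (++-identityʳ _))))
        (Dense-prefixes a l K along j n ≤n)
      ... | inj₂ ≥n = subst (λ s → Dense l (A ↓ s))
        (sym (trans (take-++ n t u) (cong (_++ take (n ℕ.∸ length t) u) (take-all n t ≥n))))
        (Dense-++⁺ l A t (take (n ℕ.∸ length t) u)
          (Along-take u (n ℕ.∸ length t) (along (j ℕ.+ K) (ℕ.m≤n+m K j))))
        where
        t = position a (j ℕ.+ K)
        u = move a (j ℕ.+ K)

      module _ (a : ℕ → ℕ) where

        -- Move `k` starts from level a(k-1) and aims at `a k`; both must be at least `l`, hence the
        -- bound `suc K`.
        along : ∀ {l K} → (∀ k → K ℕ.≤ k → l ℕ.≤ a k) →
          ∀ k → suc K ℕ.≤ k → Along (Dense l) (A ↓ position a k) (move a k)
        along {l} H (suc k) (ℕ.s≤s K≤k) =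
          let _ , _ , _ , _ , along = stage (play a (suc k)) (a (suc k))
          in along l (H k K≤k) (H (suc k) (ℕ.m≤n⇒m≤1+n K≤k))

        sparse : ∀ k → ¬ Dense (2 ℕ.+ a k) (A ↓ position a (suc k))
        sparse k = let _ , _ , sparse , _ = stage (play a k) (a k)
          in λ d → sparse (Dense-++⁻ (2 ℕ.+ a k) A (position a k) (move a k) d)

        outcome-∈Φ : EventuallyAbove a → outcome a ∈ Φ A
        outcome-∈Φ above = Dense⇒∈Φ A (outcome a) λ l →
          let K , H = above l in
          length (position a (suc K)) , λ n ≤n → subst (λ s → Dense l (A ↓ s))
            (sym (outcome-↾ a (n ℕ.+ suc K) n (ℕ.≤-trans (ℕ.m≤m+n n (suc K)) (k≤length-position a (n ℕ.+ suc K)))))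
            (Dense-prefixes a l (suc K) (along H) n n ≤n)

        -- Round `k` ends below density 1 - 2^-(a k + 2); once all densities are at least 1 -
        -- 2^-(l+2), `a k` cannot be less than `l`.
        ∈Φ-outcome : outcome a ∈ Φ A → EventuallyAbove a
        ∈Φ-outcome lim l =
          let M , H = ∈Φ⇒Dense A {outcome a} lim (2 ℕ.+ l) in
          M , λ k M≤k → let s = position a (suc k) ; k<length = k≤length-position a (suc k) in
            ℕ.≮⇒≥ λ a<l → sparse k (Dense-mono (2 ℕ.+ a k) (2 ℕ.+ l) (A ↓ s) (ℕ.s≤s (ℕ.s≤s (ℕ.<⇒≤ a<l)))
              (subst (λ s → Dense (2 ℕ.+ l) (A ↓ s))
                (trans (outcome-↾ a (suc k) (length s) ℕ.≤-refl) (take-all _ s ℕ.≤-refl))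
                (H (length s) (ℕ.≤-trans M≤k (ℕ.≤-trans (ℕ.n≤1+n k) k<length)))))

  -- Encoding a Π⁰₃ set by sequences tending to infinity.

  module _ (F : ℕ → ℕ → Subset) (closed : ∀ m n → Closed (F m n)) where

    -- Compatibility of `s` with the closed set. It depends on `s` alone, which makes each guess a
    -- function of a finite prefix of `x`.
    alive : ℕ → ℕ → List Bool → Bool
    alive m n s = does (em {∃[ y ] y ∈ N s × y ∈ F m n})

    -- The guess at stage k for an n with x ∈ F m n, moved on once it is refuted by x ↾ k.
    guess : 2^ω → ℕ → ℕ → ℕ
    guess x m zero    = 0
    guess x m (suc k) = if alive m (guess x m k) (x ↾ k) then guess x m k else suc (guess x m k)

    refuted : 2^ω → ℕ → ℕ → Bool
    refuted x k m = not (alive m (guess x m k) (x ↾ k))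

    -- The sequence that tends to infinity exactly if `x` meets, for every `m`, some `F m n`. The
    -- search is capped, with value `k` if no index below `k` is refuted.
    leastRefuted : 2^ω → ℕ → ℕ
    leastRefuted x k = least (refuted x k) k

    guess-cong : ∀ {x y} m k → x ↾ k ≡ y ↾ k → guess x m k ≡ guess y m k
    guess-cong m zero eq = refl
    guess-cong {x} {y} m (suc k) eq
      rewrite guess-cong {x} {y} m k (↾-restrict (ℕ.n≤1+n k) eq)
            | ↾-restrict {x} {y} (ℕ.n≤1+n k) eq = refl

    leastRefuted-cong : ∀ {x y} k → x ↾ k ≡ y ↾ k → leastRefuted x k ≡ leastRefuted y k
    leastRefuted-cong {x} {y} k eq =
      least-cong k λ m → cong₂ (λ n s → not (alive m n s)) (guess-cong {x} {y} m k eq) eq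

    alive-∈ : ∀ {m n x} k → x ∈ F m n → alive m n (x ↾ k) ≡ true
    alive-∈ {m} {n} {x} k x∈ = dec-true (em {∃[ y ] y ∈ N (x ↾ k) × y ∈ F m n}) (x , ∈N-↾ x k , x∈)

    guess-suc : ∀ x m k → refuted x k m ≡ true → guess x m (suc k) ≡ suc (guess x m k)
    guess-suc x m k eq with alive m (guess x m k) (x ↾ k)
    ... | false = refl

    guess-stay : ∀ x m k → refuted x k m ≡ false → guess x m (suc k) ≡ guess x m k
    guess-stay x m k eq with alive m (guess x m k) (x ↾ k)
    ... | true = refl

    -- The index `n` itself is never refuted, so the guess cannot move past it.
    guess≤ : ∀ {x m n} → x ∈ F m n → ∀ k → guess x m k ℕ.≤ n
    guess≤ x∈ zero = ℕ.z≤n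
    guess≤ {x} {m} {n} x∈ (suc k) with alive m (guess x m k) (x ↾ k) in eq
    ... | true  = guess≤ x∈ k
    ... | false = ℕ.≤∧≢⇒< (guess≤ x∈ k) λ g≡n →
      case trans (sym eq) (trans (cong (λ g → alive m g (x ↾ k)) g≡n) (alive-∈ k x∈)) of λ ()

    guess-mono : ∀ x m {k l} → k ℕ.≤′ l → guess x m k ℕ.≤ guess x m l
    guess-mono x m (ℕ.≤′-reflexive refl) = ℕ.≤-refl
    guess-mono x m (ℕ.≤′-step {l} k≤l) = ℕ.≤-trans (guess-mono x m k≤l) suc-mono
      where
      suc-mono : guess x m l ℕ.≤ guess x m (suc l)
      suc-mono with alive m (guess x m l) (x ↾ l)
      ... | true  = ℕ.≤-refl
      ... | false = ℕ.n≤1+n _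

    -- Every refutation raises the guess, which is bounded by `n`, so refutations come to an end.
    eventually-unrefuted : ∀ {x m n} → x ∈ F m n → ∃[ K ] ∀ k → K ℕ.≤ k → refuted x k m ≡ false
    eventually-unrefuted {x} {m} {n} x∈ = by-contradiction em λ never →
      let k , n<g = unbounded never (suc n) in ℕ.<⇒≱ n<g (guess≤ x∈ k)
      where
      later : ¬ (∃[ K ] ∀ k → K ℕ.≤ k → refuted x k m ≡ false) → ∀ K → ∃[ k ] K ℕ.≤ k × refuted x k m ≡ true
      later never K = by-contradiction em λ none → never (K , λ k K≤k → false! k K≤k none)
        where
        false! : ∀ k → K ℕ.≤ k → ¬ (∃[ k ] K ℕ.≤ k × refuted x k m ≡ true) → refuted x k m ≡ false
        false! k K≤k none with refuted x k m in eq
        ... | false = refl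
        ... | true  = ⊥-elim (none (k , K≤k , eq))

      unbounded : ¬ (∃[ K ] ∀ k → K ℕ.≤ k → refuted x k m ≡ false) → ∀ j → ∃[ k ] j ℕ.≤ guess x m k
      unbounded never zero = 0 , ℕ.z≤n
      unbounded never (suc j) with k , j≤g ← unbounded never j with l , k≤l , ref ← later never k =
        suc l , ℕ.≤-trans (ℕ.s≤s (ℕ.≤-trans j≤g (guess-mono x m (ℕ.≤⇒≤′ k≤l))))
                  (ℕ.≤-reflexive (sym (guess-suc x m l ref)))

    ∈-closed : ∀ {m n x} K → (∀ k → K ℕ.≤ k → alive m n (x ↾ k) ≡ true) → x ∈ F m n
    ∈-closed {m} {n} {x} K alive! = by-contradiction em λ x∉F →
      let s , x∈N , N⊆ = closed m n x∉F
          k = length s ℕ.⊔ K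
          y , y∈N , y∈F = witness k (alive! k (ℕ.m≤n⊔m (length s) K))
      in N⊆ (trans (↾-restrict {y} {x} (ℕ.m≤m⊔n (length s) K) (∈N-↾⇒≡ {x} {y} k y∈N)) x∈N) y∈F
      where
      witness : ∀ k → alive m n (x ↾ k) ≡ true → ∃[ y ] y ∈ N (x ↾ k) × y ∈ F m n
      witness k eq with em {∃[ y ] y ∈ N (x ↾ k) × y ∈ F m n}
      ... | yes found = found

    not-false : ∀ {b} → not b ≡ false → b ≡ true
    not-false {true} _ = refl

    unrefuted : ∀ {x m K} → (∀ k → K ℕ.≤ k → suc m ℕ.≤ leastRefuted x k) →
      ∀ k → K ℕ.≤ k → refuted x k m ≡ false
    unrefuted {x} {m} H k K≤k with refuted x k m in eq
    ... | false = refl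
    ... | true  = ⊥-elim (ℕ.<⇒≱ (H k K≤k) (least≤ (refuted x k) k m eq))

    settled : ∀ {x m} K → (∀ k → K ℕ.≤ k → refuted x k m ≡ false) → ∀ {k} → K ℕ.≤′ k →
      guess x m k ≡ guess x m K
    settled K H (ℕ.≤′-reflexive refl) = refl
    settled {x} {m} K H (ℕ.≤′-step {k} K≤k) =
      trans (guess-stay x m k (H k (ℕ.≤′⇒≤ K≤k))) (settled K H K≤k)

    above-if-in : ∀ {x} → (∀ m → ∃[ n ] x ∈ F m n) → EventuallyAbove (leastRefuted x)
    above-if-in {x} x∈ l = let K , H = eventually-all l (λ m → eventually-unrefuted (proj₂ (x∈ m))) in
      -- The stage must also be at least `l`, since the search at stage `k` never returns more than
      -- `k`.
      K ℕ.⊔ l , λ k K≤k → ≤least (refuted x k) (ℕ.≤-trans (ℕ.m≤n⊔m K l) K≤k)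
        (H k (ℕ.≤-trans (ℕ.m≤m⊔n K l) K≤k))

    in-if-above : ∀ {x} → EventuallyAbove (leastRefuted x) → ∀ m → ∃[ n ] x ∈ F m n
    -- Values above `m` mean that the guess for `m` is no longer refuted; it is then constant, and
    -- its final value is the required `n`.
    in-if-above {x} above m = let K , H = above (suc m) in guess x m K , ∈-closed {m} {guess x m K} {x} K λ k K≤k →
      subst (λ g → alive m g (x ↾ k) ≡ true) (settled K (λ k → unrefuted H k) (ℕ.≤⇒≤′ K≤k))
        (not-false (unrefuted H k K≤k))

  Φ-hard : ∀ A → Nonempty (Φ A) → Empty (interior (Φ A)) →
    ∀ Y → Π⁰₃ Y → Σ[ f ∈ Func Cantor Cantor ] Continuous f × Y ≐ preimage f (Φ A)
  Φ-hard A (z , z∈Φ) empty Y (F , closed , Y⇔) = f , continuous , λ x → mk⇔ (into x) (back x)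
    where
    -- A density point has a prefix at which the density is at least 1/2, and the play begins there.
    start : State A empty
    start = denseState A empty {z} (∈Φ⇒Dense A {z} z∈Φ 1)

    level : 2^ω → ℕ → ℕ
    level = leastRefuted F closed

    g : 2^ω → 2^ω
    g x = outcome A empty start (level x)

    -- Bit `n` uses `level x 0`, ..., `level x n`, and each of these reads a prefix of `x` of length
    -- at most `n`; continuity follows.
    g-local : ∀ {x y} n → x ↾ n ≡ y ↾ n → g x n ≡ g y n
    g-local {x} {y} n eq = outcome-cong A empty start (level x) (level y) n λ {i} i≤n →
      leastRefuted-cong F closed {x} {y} i (↾-restrict i≤n eq)

    f : Func Cantor Cantor
    f = record { to = g ; cong = λ {x} {y} x≗y n → g-local {x} {y} n (↾-cong x≗y n) }

    into : ∀ x → x ∈ Y → g x ∈ Φ A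
    into x x∈Y = outcome-∈Φ A empty start (level x) (above-if-in F closed {x} (to (Y⇔ x) x∈Y))

    back : ∀ x → g x ∈ Φ A → x ∈ Y
    back x gx∈Φ = from (Y⇔ x) (in-if-above F closed {x} (∈Φ-outcome A empty start (level x) gx∈Φ))

    g-↾ : ∀ x y n → y ∈ N (x ↾ n) → g y ↾ n ≡ g x ↾ n
    g-↾ x y n y∈N = ↾-ext {g y} {g x} n λ {i} i<n →
      g-local {y} {x} i (↾-restrict {y} {x} (ℕ.<⇒≤ i<n) (∈N-↾⇒≡ {x} {y} n y∈N))

    continuous : Continuous f
    continuous U open-U {x} gx∈U =
      let s , gx∈N , N⊆U = open-U {g x} gx∈U in
      x ↾ length s , ∈N-↾ x (length s) , λ {y} y∈N → N⊆U {g y} (trans (g-↾ x y (length s) y∈N) gx∈N)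

theorem1p3 : ExcludedMiddle 0ℓ → (A : Subset) → Measurable A →
    Nonempty (Φ A) → Empty (interior (Φ A)) → CompleteΠ⁰₃ (Φ A)
theorem1p3 em A _ nonempty empty = Φ-Π⁰₃ em A , Φ-hard em A nonempty empty
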